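{- Let $\mathcal H=(V,E)$ be a connected hypergraph with a ribbon structure on $\mathrm{Bip}\,\mathcal H$, a base node, and a base edge fixed. For each hypertree $\mathbf f$ on $E$ there is exactly one $E$-cut Jaeger tree $T$ such that $\mathbf f_E(T)=\mathbf f$.
   Context: $\mathrm{Bip}\,\mathcal H$ is the bipartite graph with color classes $V$ (violet) and $E$ (emerald), $v$ joined to $e$ iff $v\in e$; connected means $\mathrm{Bip}\,\mathcal H$ is connected. A hypertree on $E$ is $\mathbf f:E\to\mathbb Z_{\ge0}$ such that some spanning tree $T$ of $\mathrm{Bip}\,\mathcal H$ has $d_T(e)=\mathbf f(e)+1$ for all $e\in E$; for a spanning tree $T$, $\mathbf f_E(T)(e)=d_T(e)-1$. A ribbon structure assigns to each node $x$ a cyclic permutation of its incident edges; $xy^+$ is the edge following $xy$ at $x$. Base node $b_0$, incident base edge $b_0b_1$. Tour of a spanning tree $T$: sequence of pairs (current node, current edge) starting with $(b_0,b_0b_1)$; from $(x,xy)$ go to $(x,xy^+)$ if $xy\notin T$ and to $(y,yx^+)$ if $xy\in T$; stop right before $(b_0,b_0b_1)$ would recur. Each edge $xy$ appears exactly twice, as $(x,xy)$ and $(y,xy)$. A non-edge $xy$ of $T$ is cut at $x$ if $(x,xy)$ precedes $(y,xy)$. $T$ is an $E$-cut Jaeger tree if every non-edge of $T$ is cut at its emerald endpoint. -}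

module Defs where

open import Data.Nat using (ℕ; zero; suc; _+_; _∸_; _<_; _≤_)
open import Data.Fin using (Fin; zero; suc)
open import Data.Bool using (Bool; true; false; if_then_else_)
open import Data.Sum using (_⊎_; inj₁; inj₂)
open import Data.Product using (Σ; ∃; _×_; _,_)
open import Data.Empty using (⊥)
open import Data.List using (List; []; _∷_; length; _∷ʳ_)
open import Data.List.Relation.Unary.Unique.Propositional using (Unique)
open import Data.List.Relation.Unary.Linked using (Linked)
open import Relation.Binary.Construct.Closure.ReflexiveTransitive using (Star)
open import Relation.Binary.PropositionalEquality using (_≡_; _≢_)
open import Relation.Nullary using (¬_)

iter : {A : Set} → (A → A) → ℕ → A → A
iter f zero    x = x
iter f (suc k) x = f (iter f k x)

-- A hypergraph H = (V, E) with V = Fin m (violet), E = Fin n (emerald),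
-- given by its incidence relation: v ∈ e  iff  inc v e ≡ true.
-- (E is indexed, so repeated hyperedges are allowed.)  Bip H has an edge
-- v–e exactly when inc v e ≡ true.
record Hypergraph : Set where
  constructor hypergraph
  field
    m   : ℕ
    n   : ℕ
    inc : Fin m → Fin n → Bool
open Hypergraph public

Node : Hypergraph → Set
Node H = Fin (m H) ⊎ Fin (n H)

Adj : (H : Hypergraph) → (Fin (m H) → Fin (n H) → Bool) → Node H → Node H → Set
Adj H R (inj₁ v) (inj₂ e) = R v e ≡ true
Adj H R (inj₂ e) (inj₁ v) = R v e ≡ true
Adj H R (inj₁ _) (inj₁ _) = ⊥
Adj H R (inj₂ _) (inj₂ _) = ⊥

ConnectedSub : (H : Hypergraph) → (Fin (m H) → Fin (n H) → Bool) → Set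
ConnectedSub H R = ∀ (x y : Node H) → Star (Adj H R) x y

Connected : Hypergraph → Set
Connected H = ConnectedSub H (inc H)

HasCycle : (H : Hypergraph) → (Fin (m H) → Fin (n H) → Bool) → Set
HasCycle H R =
  Σ (Node H) λ x → Σ (List (Node H)) λ xs →
    (2 ≤ length xs) × Unique (x ∷ xs) × Linked (Adj H R) ((x ∷ xs) ∷ʳ x)

SpanningTree : (H : Hypergraph) → (Fin (m H) → Fin (n H) → Bool) → Set
SpanningTree H T =
  (∀ v e → T v e ≡ true → inc H v e ≡ true) × ConnectedSub H T × ¬ HasCycle H T

countTrue : ∀ {k} → (Fin k → Bool) → ℕ
countTrue {zero}  p = 0
countTrue {suc k} p = (if p zero then 1 else 0) + countTrue (λ i → p (suc i))

degE : (H : Hypergraph) → (Fin (m H) → Fin (n H) → Bool) → Fin (n H) → ℕ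
degE H T e = countTrue (λ v → T v e)

fE : (H : Hypergraph) → (Fin (m H) → Fin (n H) → Bool) → Fin (n H) → ℕ
fE H T e = degE H T e ∸ 1

Hypertree : (H : Hypergraph) → (Fin (n H) → ℕ) → Set
Hypertree H f =
  Σ (Fin (m H) → Fin (n H) → Bool) λ T →
    SpanningTree H T × (∀ e → degE H T e ≡ f e + 1)

-- A ribbon structure on Bip H.  At violet node v, σV v is the cyclic
-- successor on the edges v–e incident to v (represented by e); at emerald
-- node e, σE e is the cyclic successor on edges v–e (represented by v).
-- Cyclic permutation of the incident edges: maps incident edges to incident
-- edges and every incident edge is reached from every other by iteration
-- (on a finite set this forces a single-cycle bijection).  Values at
-- non-incident arguments are irrelevant.
record Ribbon (H : Hypergraph) : Set where
  field
    σV     : Fin (m H) → Fin (n H) → Fin (n H)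
    σV-inc : ∀ v e → inc H v e ≡ true → inc H v (σV v e) ≡ true
    σV-cyc : ∀ v e e′ → inc H v e ≡ true → inc H v e′ ≡ true →
             ∃ λ k → iter (σV v) k e ≡ e′
    σE     : Fin (n H) → Fin (m H) → Fin (m H)
    σE-inc : ∀ e v → inc H v e ≡ true → inc H (σE e v) e ≡ true
    σE-cyc : ∀ e v v′ → inc H v e ≡ true → inc H v′ e ≡ true →
             ∃ λ k → iter (σE e) k v ≡ v′
open Ribbon public

-- States of a tour: (current node, current edge).
--   atV v e : node v (violet), edge v–e
--   atE e v : node e (emerald), edge v–e
data St (H : Hypergraph) : Set where
  atV : Fin (m H) → Fin (n H) → St H
  atE : Fin (n H) → Fin (m H) → St H

ValidSt : (H : Hypergraph) → St H → Set
ValidSt H (atV v e) = inc H v e ≡ true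
ValidSt H (atE e v) = inc H v e ≡ true

step : (H : Hypergraph) → Ribbon H → (Fin (m H) → Fin (n H) → Bool) → St H → St H
step H ρ T (atV v e) = if T v e then atE e (σE ρ e v) else atV v (σV ρ v e)
step H ρ T (atE e v) = if T v e then atV v (σV ρ v e) else atE e (σE ρ e v)

-- k-th state of the tour started at the base state s₀ = (b₀, b₀b₁)
tourAt : (H : Hypergraph) → Ribbon H → (Fin (m H) → Fin (n H) → Bool) →
         St H → ℕ → St H
tourAt H ρ T s₀ k = iter (step H ρ T) k s₀

-- a precedes b in the tour: a occurs at position i, b at position j > i,
-- and the tour has not yet stopped (s₀ does not recur at positions 1..j).
Precedes : (H : Hypergraph) → Ribbon H → (Fin (m H) → Fin (n H) → Bool) →
           St H → St H → St H → Set
Precedes H ρ T s₀ a b =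
  Σ ℕ λ i → Σ ℕ λ j →
    i < j × tourAt H ρ T s₀ i ≡ a × tourAt H ρ T s₀ j ≡ b ×
    (∀ k → 0 < k → k ≤ j → tourAt H ρ T s₀ k ≢ s₀)

ECutJaeger : (H : Hypergraph) → Ribbon H → St H → (Fin (m H) → Fin (n H) → Bool) → Set
ECutJaeger H ρ s₀ T =
  SpanningTree H T ×
  (∀ v e → inc H v e ≡ true → T v e ≡ false → Precedes H ρ T s₀ (atE e v) (atV v e))

-- A tour meets an edge first at one of its ends and can decide there whether to keep
-- it; the greedy wish is to leave it out at an emerald node and to keep it at a violet
-- one. Record a tree by the 0-1 word of granted wishes along its tour.
--
-- Existence: let T realize f and have a non-edge ve that is met first at v. Adding ve
-- and removing the other edge at e on the cycle so formed preserves f, and the words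
-- of the two trees first differ where the new one grants a wish: the removed edge can
-- only have been met at e, as otherwise the tour would have seen ve from e before.
-- Hence the word grows lexicographically, and this process ends in a Jaeger tree.
--
-- Uniqueness: let the tours of two E-cut Jaeger trees T and T' first disagree at an
-- edge ve of T. This happens at e, and every edge joining an emerald node on the
-- e-side X of T - ve to a violet node outside X is ve or has been rejected before.
-- So T has |X| edges with emerald end in X, while those of T' form a forest on X and
-- are fewer, although f prescribes their number.
module Submission where

open import Defs
open import Data.Nat using (ℕ; zero; suc; _+_; _*_; _∸_; _^_; _≤_; _<_; z≤n; s≤s; s≤s⁻¹)
open import Data.Nat.Properties using
  ( ≤-refl; ≤-trans; ≤-reflexive; <-≤-trans; ≤-<-trans; <⇒≤; <-irrefl; <-cmp; ≤-<-connex
  ; m≤n⇒m<n∨m≡n; m+[n∸m]≡n; m∸n≤m; m<n⇒0<n∸m; +-suc; +-comm; +-identityʳ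
  ; +-monoˡ-≤; +-monoʳ-<; m≤m+n; m≤n+m; n<1+n; n≤1+n; m+n∸n≡m; m∸n+n≡m; 1+n≰n)
open import Data.Nat.DivMod using (_/_; _%_; m≡m%n+[m/n]*n; m%n<n)
open import Data.Nat.Tactic.RingSolver using (solve-∀)
open import Data.Fin using (Fin; zero; suc; toℕ; inject≤; join; splitAt; combine)
import Data.Fin.Properties as Fin
open import Data.Bool using (Bool; true; false; if_then_else_; not; _xor_; _∨_)
import Data.Bool.Properties as Bool
open import Data.Sum using (_⊎_; inj₁; inj₂; map₂)
open import Data.Sum.Properties using (inj₁-injective; inj₂-injective)
import Data.Sum.Properties as Sum
open import Data.Product using (Σ; ∃; _×_; _,_; proj₁; proj₂)
open import Data.Empty using (⊥; ⊥-elim)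
open import Data.List using (List; []; _∷_; length; _∷ʳ_)
open import Data.List.Relation.Unary.Any using (Any; here; there; any?)
open import Data.List.Relation.Unary.All using (All; []; _∷_)
open import Data.List.Relation.Unary.All.Properties using (¬Any⇒All¬)
open import Data.List.Relation.Unary.AllPairs using ([]; _∷_)
open import Data.List.Relation.Unary.Unique.Propositional using (Unique)
open import Data.List.Relation.Unary.Linked using (Linked; [-]; _∷_)
open import Relation.Binary.Construct.Closure.ReflexiveTransitive using (Star; ε; _◅_; _◅◅_; reverse)
open import Relation.Binary using (tri<; tri≈; tri>)
open import Relation.Binary.PropositionalEquality using (_≡_; _≢_; refl; sym; trans; cong; cong₂; subst; module ≡-Reasoning)
open import Relation.Nullary using (¬_; Dec; yes; no; does; contradiction)
open import Relation.Nullary.Decidable using (map′; dec-true; dec-false; _×-dec_; ¬?; decidable-stable)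
open import Function using (_∘_)

-- Booleans as two colours

≢⇒both≡ : ∀ {a b c : Bool} → a ≢ b → c ≢ b → a ≡ c
≢⇒both≡ a≢b c≢b = trans (Bool.¬-not a≢b) (sym (Bool.¬-not c≢b))

true≢false : true ≢ false
true≢false ()

xor-both-differ : ∀ {a b c d} → a ≢ b → c ≢ d → a xor c ≡ b xor d
xor-both-differ {b = b} {d = d} a≢b c≢d =
  trans (cong₂ _xor_ (Bool.¬-not a≢b) (Bool.¬-not c≢d)) (Bool.xor-annihilates-not b d)

xor-left-differs : ∀ {a b c d} → a ≢ b → c ≡ d → a xor c ≢ b xor d
xor-left-differs {true}  {true}  a≢b _ = contradiction refl a≢b
xor-left-differs {false} {false} a≢b _ = contradiction refl a≢b
xor-left-differs {true}  {false} {true}  _ refl ()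
xor-left-differs {true}  {false} {false} _ refl ()
xor-left-differs {false} {true}  {true}  _ refl ()
xor-left-differs {false} {true}  {false} _ refl ()

-- Iterated maps and first times

module _ {A : Set} (g : A → A) where

  iter-+ : ∀ a b x → iter g (a + b) x ≡ iter g a (iter g b x)
  iter-+ zero    b x = refl
  iter-+ (suc a) b x = cong g (iter-+ a b x)

  iter-period : ∀ p x → iter g p x ≡ x → ∀ q → iter g (q * p) x ≡ x
  iter-period p x eq zero    = refl
  iter-period p x eq (suc q) =
    trans (iter-+ p (q * p) x) (trans (cong (iter g p) (iter-period p x eq q)) eq)

  -- Both a + 1 and b + 1 are periods of g y, so y and z are the state at the same
  -- time a + b (a + 1) = b + a (b + 1).
  preimage-unique : ∀ {y z} a b → iter g a (g y) ≡ y → iter g b (g z) ≡ z → g y ≡ g z → y ≡ z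
  preimage-unique {y} {z} a b ya zb gy≡gz = begin
    y                                          ≡⟨ ya ⟨
    iter g a (g y)                             ≡⟨ cong (iter g a) (iter-period (suc a) (g y) (cong g ya) b) ⟨
    iter g a (iter g (b * suc a) (g y))        ≡⟨ iter-+ a (b * suc a) (g y) ⟨
    iter g (a + b * suc a) (g y)               ≡⟨ cong₂ (iter g) (times a b) gy≡gz ⟩
    iter g (b + a * suc b) (g z)               ≡⟨ iter-+ b (a * suc b) (g z) ⟩
    iter g b (iter g (a * suc b) (g z))        ≡⟨ cong (iter g b) (iter-period (suc b) (g z) (cong g zb) a) ⟩
    iter g b (g z)                             ≡⟨ zb ⟩
    z                                          ∎
    where
    open ≡-Reasoning
    times : ∀ a b → a + b * suc a ≡ b + a * suc b
    times = solve-∀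

least : (P : ℕ → Set) → (∀ k → Dec (P k)) → ∀ i → P i →
        Σ ℕ λ t → t ≤ i × P t × (∀ k → k < t → ¬ P k)
least P P? i p with P? 0
... | yes p₀ = 0 , z≤n , p₀ , λ _ ()
least P P? zero    p | no ¬p₀ = contradiction p ¬p₀
least P P? (suc i) p | no ¬p₀ with least (P ∘ suc) (P? ∘ suc) i p
... | t , t≤i , pt , before = suc t , s≤s t≤i , pt ,
      λ { zero _ → ¬p₀ ; (suc k) k<t → before k (s≤s⁻¹ k<t) }

-- Walk to the first change of `g`: with two values only, the new one is `g b`. Applied to the
-- colour of the current node, this finds where a tour crosses a cut.
switch : (g : ℕ → Bool) → ∀ a b → a ≤ b → g a ≢ g b →
         Σ ℕ λ c → a ≤ c × c < b × g c ≡ g a × g (suc c) ≡ g b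
switch g a b a≤b ga≢gb =
  subst (λ b → g a ≢ g b → Σ ℕ λ c → a ≤ c × c < b × g c ≡ g a × g (suc c) ≡ g b)
        (m+[n∸m]≡n a≤b) (go a (b ∸ a)) ga≢gb
  where
  go : ∀ a d → g a ≢ g (a + d) → Σ ℕ λ c → a ≤ c × c < a + d × g c ≡ g a × g (suc c) ≡ g (a + d)
  go a zero    ga≢ = contradiction (cong g (sym (+-identityʳ a))) ga≢
  go a (suc d) ga≢ rewrite +-suc a d with g (suc a) Bool.≟ g a
  ... | no  moved  = a , ≤-refl , s≤s (m≤m+n a d) , refl , ≢⇒both≡ moved (ga≢ ∘ sym)
  ... | yes stayed with go (suc a) d (ga≢ ∘ trans (sym stayed))
  ...   | c , a<c , c<b , gc , gb = c , <⇒≤ a<c , c<b , trans gc stayed , gb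

-- Binary words

-- The value of the binary word of length N whose most significant digit is w 0:
-- on words of this length it turns the lexicographic order into the order of ℕ.
binary : ℕ → (ℕ → Bool) → ℕ
binary zero    w = 0
binary (suc N) w = (if w 0 then 2 ^ N else 0) + binary N (w ∘ suc)

-- A leading digit 1 thus outweighs everything after it; the bound also limits how often the value
-- can grow.
binary<2^ : ∀ N w → binary N w < 2 ^ N
binary<2^ zero    w = s≤s z≤n
binary<2^ (suc N) w = digit (w 0)
  where
  digit : ∀ b → (if b then 2 ^ N else 0) + binary N (w ∘ suc) < 2 ^ suc N
  digit true  rewrite +-identityʳ (2 ^ N) = +-monoʳ-< (2 ^ N) (binary<2^ N (w ∘ suc))
  digit false = <-≤-trans (binary<2^ N (w ∘ suc)) (m≤m+n (2 ^ N) _)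

binary-mono : ∀ N w w′ t → t < N → (∀ k → k < t → w k ≡ w′ k) → w t ≡ false → w′ t ≡ true →
              binary N w < binary N w′
binary-mono (suc N) w w′ zero _ _ wt w′t rewrite wt | w′t =
  <-≤-trans (binary<2^ N (w ∘ suc)) (m≤m+n (2 ^ N) _)
binary-mono (suc N) w w′ (suc t) t<N agree wt w′t rewrite agree 0 (s≤s z≤n) =
  +-monoʳ-< (if w′ 0 then 2 ^ N else 0)
    (binary-mono N (w ∘ suc) (w′ ∘ suc) t (s≤s⁻¹ t<N) (λ k k<t → agree (suc k) (s≤s k<t)) wt w′t)

-- Finite search and counting

Fin-all⊎any : ∀ {k} {A B : Fin k → Set} → (∀ i → A i ⊎ B i) → (∀ i → A i) ⊎ ∃ B
Fin-all⊎any {zero}  c = inj₁ λ ()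
Fin-all⊎any {suc k} c with c zero | Fin-all⊎any (c ∘ suc)
... | inj₂ b | _            = inj₂ (zero , b)
... | inj₁ _ | inj₂ (i , b) = inj₂ (suc i , b)
... | inj₁ a | inj₁ as      = inj₁ λ { zero → a ; (suc i) → as i }

join-injective : ∀ a b {x y : Fin a ⊎ Fin b} → join a b x ≡ join a b y → x ≡ y
join-injective a b {x} {y} eq =
  trans (sym (Fin.splitAt-join a b x)) (trans (cong (splitAt a) eq) (Fin.splitAt-join a b y))

-- If `r` were missed, `punchOut` would turn `g` into an injection into a set with one element
-- fewer.
injection-hits : ∀ {k} (g : Fin k → Fin k) → (∀ {i j} → g i ≡ g j → i ≡ j) →
                 ∀ r → ¬ (∀ i → r ≢ g i)
injection-hits {suc k} g g-injective r missed =
  1+n≰n (Fin.injective⇒≤ (λ {i} {j} eq → g-injective (Fin.punchOut-injective (missed i) (missed j) eq)))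

countTrue-cong : ∀ {k} {p q : Fin k → Bool} → (∀ i → p i ≡ q i) → countTrue p ≡ countTrue q
countTrue-cong {zero}  eq = refl
countTrue-cong {suc k} eq =
  cong₂ _+_ (cong (if_then 1 else 0) (eq zero)) (countTrue-cong (eq ∘ suc))

countTrue-insert : ∀ {k} (p q : Fin k → Bool) i → p i ≡ false → q i ≡ true →
                   (∀ j → j ≢ i → p j ≡ q j) → countTrue q ≡ suc (countTrue p)
countTrue-insert p q zero pi qi eq rewrite pi | qi =
  cong suc (sym (countTrue-cong (λ j → eq (suc j) λ ())))
countTrue-insert p q (suc i) pi qi eq rewrite eq zero (λ ()) =
  trans (cong ((if q zero then 1 else 0) +_)
          (countTrue-insert (p ∘ suc) (q ∘ suc) i pi qi (λ j j≢i → eq (suc j) (j≢i ∘ Fin.suc-injective))))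
        (+-suc _ _)

countTrue>0 : ∀ {k} (p : Fin k → Bool) i → p i ≡ true → 0 < countTrue p
countTrue>0 p zero    pi rewrite pi = s≤s z≤n
countTrue>0 p (suc i) pi = ≤-trans (countTrue>0 (p ∘ suc) i pi) (m≤n+m _ _)

rank : ∀ {k} (p : Fin k → Bool) i → p i ≡ true → Fin (countTrue p)
rank p zero    pi with p zero
rank p zero    () | false
... | true  = zero
rank p (suc i) pi with p zero
... | true  = suc (rank (p ∘ suc) i pi)
... | false = rank (p ∘ suc) i pi

rank-injective : ∀ {k} (p : Fin k → Bool) i j (pi : p i ≡ true) (pj : p j ≡ true) →
                 rank p i pi ≡ rank p j pj → i ≡ j
rank-injective p zero    zero    pi pj eq = refl
rank-injective p zero    (suc j) pi pj eq with p zero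
rank-injective p zero    (suc j) refl pj () | true
rank-injective p (suc i) zero    pi pj eq with p zero
rank-injective p (suc i) zero    pi refl () | true
rank-injective p (suc i) (suc j) pi pj eq with p zero
... | true  = cong suc (rank-injective (p ∘ suc) i j pi pj (Fin.suc-injective eq))
... | false = cong suc (rank-injective (p ∘ suc) i j pi pj eq)

select : ∀ {k} (p : Fin k → Bool) → Fin (countTrue p) → Fin k
select {suc k} p r with p zero
select {suc k} p zero    | true  = zero
select {suc k} p (suc r) | true  = suc (select (p ∘ suc) r)
select {suc k} p r       | false = suc (select (p ∘ suc) r)

select-true : ∀ {k} (p : Fin k → Bool) r → p (select p r) ≡ true
select-true {suc k} p r with p zero in eq
select-true {suc k} p zero    | true  = eq
select-true {suc k} p (suc r) | true  = select-true (p ∘ suc) r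
select-true {suc k} p r       | false = select-true (p ∘ suc) r

select-injective : ∀ {k} (p : Fin k → Bool) r s → select p r ≡ select p s → r ≡ s
select-injective {suc k} p r s eq with p zero
select-injective {suc k} p zero    zero    eq | true = refl
select-injective {suc k} p (suc r) (suc s) eq | true =
  cong suc (select-injective (p ∘ suc) r s (Fin.suc-injective eq))
select-injective {suc k} p r s eq | false = select-injective (p ∘ suc) r s (Fin.suc-injective eq)

-- Number the true indices of `p` by `rank`, then look the number up among those of `q` by `select`.
countTrue-≤⇒injection : ∀ {k} (p q : Fin k → Bool) → countTrue p ≤ countTrue q →
  Σ (∀ i → p i ≡ true → Fin k) λ φ →
    (∀ i pi → q (φ i pi) ≡ true) × (∀ i j pi pj → φ i pi ≡ φ j pj → i ≡ j)
countTrue-≤⇒injection p q p≤q =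
  (λ i pi → select q (inject≤ (rank p i pi) p≤q)) ,
  (λ i pi → select-true q _) ,
  λ i j pi pj eq → rank-injective p i j pi pj
    (Fin.inject≤-injective p≤q p≤q _ _ (select-injective q _ _ eq))

-- Edge sets, darts and walks

EdgeSet : Hypergraph → Set
EdgeSet H = Fin (m H) → Fin (n H) → Bool

module _ {H : Hypergraph} where

  infix 4 _∈_ _∉_ _≟ᴺ_ _≟ˢ_

  -- A tour state doubles as a dart, an edge directed away from its current node; `flip` reverses
  -- it.
  flip : St H → St H
  flip (atV v e) = atE e v
  flip (atE e v) = atV v e

  src tgt : St H → Node H
  src (atV v e) = inj₁ v
  src (atE e v) = inj₂ e
  tgt = src ∘ flip

  has : EdgeSet H → St H → Bool
  has R (atV v e) = R v e
  has R (atE e v) = R v e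

  _∈_ _∉_ : St H → EdgeSet H → Set
  d ∈ R = has R d ≡ true
  d ∉ R = has R d ≡ false

  flip-involutive : ∀ d → flip (flip d) ≡ d
  flip-involutive (atV v e) = refl
  flip-involutive (atE e v) = refl

  has-flip : ∀ R d → has R (flip d) ≡ has R d
  has-flip R (atV v e) = refl
  has-flip R (atE e v) = refl

  tgt-flip : ∀ d → tgt (flip d) ≡ src d
  tgt-flip d = cong src (flip-involutive d)

  src≢tgt : ∀ d → src d ≢ tgt d
  src≢tgt (atV v e) ()
  src≢tgt (atE e v) ()

  dart-ext : ∀ c d → src c ≡ src d → tgt c ≡ tgt d → c ≡ d
  dart-ext (atV v e) (atV .v .e) refl refl = refl
  dart-ext (atE e v) (atE .e .v) refl refl = refl

  _≟ᴺ_ : (x y : Node H) → Dec (x ≡ y)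
  _≟ᴺ_ = Sum.≡-dec Fin._≟_ Fin._≟_

  _≟ˢ_ : (c d : St H) → Dec (c ≡ d)
  c ≟ˢ d = map′ (λ (p , q) → dart-ext c d p q) (λ { refl → refl , refl })
                (src c ≟ᴺ src d ×-dec tgt c ≟ᴺ tgt d)

  ∉⇒≢ : ∀ {R c d} → c ∈ R → d ∉ R → c ≢ d
  ∉⇒≢ c∈ c∉ refl = true≢false (trans (sym c∈) c∉)

  ∈-flip : ∀ {R d} → d ∈ R → flip d ∈ R
  ∈-flip {R} {d} = trans (has-flip R d)

  valid⇒∈ : ∀ d → ValidSt H d → d ∈ inc H
  valid⇒∈ (atV v e) d∈ = d∈
  valid⇒∈ (atE e v) d∈ = d∈

  _⊆_ : (R R′ : EdgeSet H) → Set
  R ⊆ R′ = ∀ d → d ∈ R → d ∈ R′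

  ⊆-intro : ∀ {R R′} → (∀ v e → R v e ≡ true → R′ v e ≡ true) → R ⊆ R′
  ⊆-intro R⊆ (atV v e) = R⊆ v e
  ⊆-intro R⊆ (atE e v) = R⊆ v e

  dart⇒adj : ∀ {R} d → d ∈ R → Adj H R (src d) (tgt d)
  dart⇒adj (atV v e) d∈ = d∈
  dart⇒adj (atE e v) d∈ = d∈

  adj⇒dart : ∀ {R} x y → Adj H R x y → Σ (St H) λ d → d ∈ R × src d ≡ x × tgt d ≡ y
  adj⇒dart (inj₁ v) (inj₂ e) a = atV v e , a , refl , refl
  adj⇒dart (inj₂ e) (inj₁ v) a = atE e v , a , refl , refl

  edge : ∀ {R} d → d ∈ R → Star (Adj H R) (src d) (tgt d)
  edge d d∈ = dart⇒adj d d∈ ◅ ε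

  walk-map : ∀ {R R′ : EdgeSet H} →
             (∀ d → d ∈ R → Star (Adj H R′) (src d) (tgt d)) →
             ∀ {x y} → Star (Adj H R) x y → Star (Adj H R′) x y
  walk-map f ε = ε
  walk-map f (_◅_ {x} {y} a w) with adj⇒dart x y a
  ... | d , d∈ , refl , refl = f d d∈ ◅◅ walk-map f w

  walk-constant : ∀ {R} (g : Node H → Bool) → (∀ d → d ∈ R → g (src d) ≡ g (tgt d)) →
                  ∀ {x y} → Star (Adj H R) x y → g x ≡ g y
  walk-constant g const ε = refl
  walk-constant g const (_◅_ {x} {y} a w) with adj⇒dart x y a
  ... | d , d∈ , refl , refl = trans (const d d∈) (walk-constant g const w)

  adj-sym : ∀ {R x y} → Adj H R x y → Adj H R y x
  adj-sym {x = x} {y} a with adj⇒dart x y a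
  ... | d , d∈ , refl , refl = subst (Adj H _ (tgt d)) (tgt-flip d) (dart⇒adj (flip d) (∈-flip {d = d} d∈))

  walk-sym : ∀ {R x y} → Star (Adj H R) x y → Star (Adj H R) y x
  walk-sym = reverse adj-sym

  update : EdgeSet H → St H → Bool → EdgeSet H
  update R d b v e = if does (atV v e ≟ˢ d) ∨ does (atE e v ≟ˢ d) then b else R v e

  update-at : ∀ R d b → has (update R d b) d ≡ b
  update-at R d@(atV v e) b rewrite dec-true (d ≟ˢ d) refl = refl
  update-at R d@(atE e v) b rewrite dec-true (d ≟ˢ d) refl = refl

  update-flip : ∀ R d b → has (update R d b) (flip d) ≡ b
  update-flip R d b = trans (has-flip (update R d b) d) (update-at R d b)

  update-off : ∀ R d b c → c ≢ d → c ≢ flip d → has (update R d b) c ≡ has R c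
  update-off R d b c@(atV v e) c≢d c≢fd
    rewrite dec-false (c ≟ˢ d) c≢d | dec-false (flip c ≟ˢ d) (λ { refl → c≢fd refl }) = refl
  update-off R d b c@(atE e v) c≢d c≢fd
    rewrite dec-false (c ≟ˢ d) c≢d | dec-false (flip c ≟ˢ d) (λ { refl → c≢fd refl }) = refl

  update-∈ : ∀ R d b c → c ∈ update R d b → (b ≡ true × (c ≡ d ⊎ c ≡ flip d)) ⊎ (c ∈ R × c ≢ d × c ≢ flip d)
  update-∈ R d b c c∈ with c ≟ˢ d | c ≟ˢ flip d
  ... | yes refl | _        = inj₁ (trans (sym (update-at R d b)) c∈ , inj₁ refl)
  ... | no _     | yes refl = inj₁ (trans (sym (update-flip R d b)) c∈ , inj₂ refl)
  ... | no c≢d   | no c≢fd  = inj₂ (trans (sym (update-off R d b c c≢d c≢fd)) c∈ , c≢d , c≢fd)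

  _∖_ : EdgeSet H → St H → EdgeSet H
  R ∖ d = update R d false

  ∖-∈ : ∀ {R d c} → c ∈ R ∖ d → c ∈ R × c ≢ d × c ≢ flip d
  ∖-∈ {R} {d} {c} c∈ with update-∈ R d false c c∈
  ... | inj₂ off = off

  ∈-∖ : ∀ {R d c} → c ∈ R → c ≢ d → c ≢ flip d → c ∈ R ∖ d
  ∈-∖ {R} {d} {c} c∈ c≢d c≢fd = trans (update-off R d false c c≢d c≢fd) c∈

  -- Cuts and trees

  -- A 2-colouring of the nodes certifying that d is a bridge: it is the only edge
  -- of R whose endpoints have different colours.
  record Cut (R : EdgeSet H) (d : St H) : Set where
    field
      side      : Node H → Bool
      separates : side (src d) ≢ side (tgt d)
      constant  : ∀ c → c ∈ R → c ≢ d → c ≢ flip d → side (src c) ≡ side (tgt c)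
  open Cut

  cut-flip : ∀ {R d} → Cut R d → Cut R (flip d)
  cut-flip {R} {d} C .side          = side C
  cut-flip {R} {d} C .separates eq  = separates C (trans (cong (side C) (sym (tgt-flip d))) (sym eq))
  cut-flip {R} {d} C .constant c c∈ c≢fd c≢ffd =
    constant C c c∈ (λ { refl → c≢ffd (sym (flip-involutive d)) }) c≢fd

  crossing : ∀ {R d} (C : Cut R d) c → c ∈ R → side C (src c) ≢ side C (tgt c) → c ≡ d ⊎ c ≡ flip d
  crossing {d = d} C c c∈ diff with c ≟ˢ d | c ≟ˢ flip d
  ... | yes eq | _      = inj₁ eq
  ... | no _   | yes eq = inj₂ eq
  ... | no c≢d | no c≢fd = contradiction (constant C c c∈ c≢d c≢fd) diff

  -- One cut per edge takes the place of acyclicity: colourings can be followed along a tour and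
  -- added modulo 2.
  IsTree : EdgeSet H → Set
  IsTree T = ConnectedSub H T × (∀ d → d ∈ T → Cut T d)

  -- Stop a walk to an end of d as soon as it is about to traverse d.
  reach-end : ∀ {R} d {x} → Star (Adj H R) x (src d) →
              Star (Adj H (R ∖ d)) x (src d) ⊎ Star (Adj H (R ∖ d)) x (tgt d)
  reach-end d ε = inj₁ ε
  reach-end d (_◅_ {x} {y} a w) with adj⇒dart x y a
  ... | c , c∈ , refl , refl with c ≟ˢ d | c ≟ˢ flip d
  ...   | yes refl | _        = inj₁ ε
  ...   | no _     | yes refl = inj₂ ε
  ...   | no c≢d   | no c≢fd  with reach-end d w
  ...     | inj₁ w′ = inj₁ (edge c (∈-∖ {d = d} c∈ c≢d c≢fd) ◅◅ w′)
  ...     | inj₂ w′ = inj₂ (edge c (∈-∖ {d = d} c∈ c≢d c≢fd) ◅◅ w′)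

  data Path (R : EdgeSet H) : Node H → List (Node H) → Node H → Set where
    []  : ∀ {x} → Path R x [] x
    _∷_ : ∀ {x y ys z} → Adj H R x y → Path R y ys z → Path R x (y ∷ ys) z

  path-from : ∀ {R x y ys z} → Any (x ≡_) (y ∷ ys) → Path R y ys z → Unique (y ∷ ys) →
              Σ (List (Node H)) λ xs → Path R x xs z × Unique (x ∷ xs)
  path-from (here refl)         p       u       = _ , p , u
  path-from (there x∈) (_ ∷ p) (_ ∷ u) = path-from x∈ p u

  simple-path : ∀ {R x z} → Star (Adj H R) x z → Σ (List (Node H)) λ xs → Path R x xs z × Unique (x ∷ xs)
  simple-path ε = [] , [] , [] ∷ []
  simple-path (_◅_ {x} {y} a w) with simple-path w
  ... | ys , p , u with any? (x ≟ᴺ_) (y ∷ ys)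
  ...   | yes x∈ = path-from x∈ p u
  ...   | no x∉  = y ∷ ys , a ∷ p , ¬Any⇒All¬ _ x∉ ∷ u

  close-path : ∀ {R R′ x xs y z} → R ⊆ R′ → Path R x xs y → Adj H R′ y z → Linked (Adj H R′) ((x ∷ xs) ∷ʳ z)
  close-path R⊆ [] b = b ∷ [-]
  close-path R⊆ (_∷_ {x} {y} a p) b with adj⇒dart x y a
  ... | d , d∈ , refl , refl = dart⇒adj d (R⊆ d d∈) ∷ close-path R⊆ p b

  -- A walk around `d`, made simple and closed by `d`, would be a cycle. It has at least two steps,
  -- since the only one-step path between the ends is `d` itself, which is deleted.
  bridge : ∀ {T} → ¬ HasCycle H T → ∀ d → d ∈ T → ¬ Star (Adj H (T ∖ d)) (src d) (tgt d)
  bridge {T} acyclic d d∈ w with simple-path w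
  ... | xs , p , u = acyclic (src d , xs , long xs p refl , u , close-path (λ c c∈ → proj₁ (∖-∈ {d = d} {c} c∈)) p closing)
    where
    closing : Adj H T (tgt d) (src d)
    closing = adj-sym (dart⇒adj d d∈)
    long : ∀ {z} xs → Path (T ∖ d) (src d) xs z → z ≡ tgt d → 2 ≤ length xs
    long [] [] eq = contradiction eq (src≢tgt d)
    long {z} (_ ∷ []) (a ∷ []) eq with adj⇒dart (src d) z a
    ... | c , c∈ , sc , tc = contradiction (dart-ext c d sc (trans tc eq)) (proj₁ (proj₂ (∖-∈ {d = d} {c} c∈)))
    long (_ ∷ _ ∷ _) _ _ = s≤s (s≤s z≤n)

  -- Without `d` every node still reaches an end of `d`, and by `bridge` only one of them; that end
  -- is its colour.
  spanning⇒tree : ∀ {T} → SpanningTree H T → IsTree T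
  spanning⇒tree {T} (_ , conn , acyclic) = conn , cut
    where
    cut : ∀ d → d ∈ T → Cut T d
    cut d d∈ = record { side = colour ∘ ends ; separates = sep _ _ ; constant = const }
      where
      End : Node H → Set
      End x = Star (Adj H (T ∖ d)) x (src d) ⊎ Star (Adj H (T ∖ d)) x (tgt d)
      colour : ∀ {x} → End x → Bool
      colour (inj₁ _) = true
      colour (inj₂ _) = false
      ends : ∀ x → End x
      ends x = reach-end d (conn x (src d))
      agree : ∀ {x y} → Star (Adj H (T ∖ d)) x y → (p : End x) (q : End y) → colour p ≡ colour q
      agree w (inj₁ _) (inj₁ _) = refl
      agree w (inj₂ _) (inj₂ _) = refl
      agree w (inj₁ p) (inj₂ q) = contradiction (walk-sym p ◅◅ w ◅◅ q) (bridge acyclic d d∈)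
      agree w (inj₂ p) (inj₁ q) = contradiction (walk-sym q ◅◅ walk-sym w ◅◅ p) (bridge acyclic d d∈)
      sep : (p : End (src d)) (q : End (tgt d)) → colour p ≢ colour q
      sep p q eq with trans (sym (agree ε p (inj₁ ε))) (trans eq (agree ε q (inj₂ ε)))
      ... | ()
      const : ∀ c → c ∈ T → c ≢ d → c ≢ flip d → colour (ends (src c)) ≡ colour (ends (tgt c))
      const c c∈ c≢d c≢fd = agree (edge c (∈-∖ {d = d} c∈ c≢d c≢fd)) _ _

  -- A cycle leaves x through its first edge and comes back to x without using it,
  -- although the cut at that edge says it cannot.
  tree⇒acyclic : ∀ {T} → IsTree T → ¬ HasCycle H T
  tree⇒acyclic _ (x , _ ∷ [] , s≤s () , _)
  tree⇒acyclic {T} (_ , cuts) (x , y ∷ z ∷ zs , _ , (x≢y ∷ x≢z ∷ _) ∷ (y≢z ∷ y≢zs) ∷ _ , a ∷ b ∷ l)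
    with adj⇒dart x y a
  ... | d , d∈ , refl , refl = separates C (sym (trans first (back z zs l (y≢z ∷ y≢zs))))
    where
    C : Cut T d
    C = cuts d d∈
    back : ∀ u us → Linked (Adj H T) ((u ∷ us) ∷ʳ src d) → All (tgt d ≢_) (u ∷ us) → side C u ≡ side C (src d)
    back u us l (y≢u ∷ y≢us) = go us l y≢us
      where
      avoid : ∀ {w} → Adj H T u w → tgt d ≢ w → side C u ≡ side C w
      avoid {w} a y≢w with adj⇒dart u w a
      ... | g , g∈ , refl , refl = constant C g g∈ (λ { refl → y≢w refl }) (λ { refl → y≢u refl })
      go : ∀ us → Linked (Adj H T) ((u ∷ us) ∷ʳ src d) → All (tgt d ≢_) us → side C u ≡ side C (src d)
      go []       (a ∷ [-]) []           = avoid a (src≢tgt d ∘ sym)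
      go (w ∷ ws) (a ∷ l)   (y≢w ∷ y≢ws) = trans (avoid a y≢w) (back w ws l (y≢w ∷ y≢ws))
    first : side C (tgt d) ≡ side C z
    first with adj⇒dart (tgt d) z b
    ... | g , g∈ , sg , refl =
      trans (cong (side C) (sym sg))
        (constant C g g∈ (λ { refl → src≢tgt d sg }) (λ { refl → x≢z (sym (tgt-flip d)) }))

  -- Parent edges

  -- Parent T r x is about the first edge on the way from x to r, described through
  -- cuts only.
  record Parent (T : EdgeSet H) (r x : Node H) : Set where
    field
      dart        : St H
      dart∈       : dart ∈ T
      dart-src    : src dart ≡ x
      separated   : ∀ c (C : Cut T c) → c ≡ dart → side C x ≢ side C r
      unseparated : ∀ c (C : Cut T c) → src c ≡ x → c ≢ dart → side C x ≡ side C r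

  -- Stop the walk when it first enters `x` and reverse the last dart. All darts before it avoid
  -- `x`, so they carry the colour of `r` to `tgt d`.
  first-arrival : ∀ {T r x} → Star (Adj H T) r x → r ≢ x →
    Σ (St H) λ d → d ∈ T × src d ≡ x ×
      (∀ (g : Node H → Bool) → (∀ c → c ∈ T → src c ≢ x → tgt c ≢ x → g (src c) ≡ g (tgt c)) → g r ≡ g (tgt d))
  first-arrival ε r≢x = contradiction refl r≢x
  first-arrival {x = x} (_◅_ {r} {y} a w) r≢x with adj⇒dart r y a | y ≟ᴺ x
  ... | c , c∈ , refl , refl | yes refl =
    flip c , ∈-flip {d = c} c∈ , refl , λ g _ → cong g (sym (tgt-flip c))
  ... | c , c∈ , refl , refl | no y≢x with first-arrival w y≢x
  ...   | d , d∈ , sd , constancy = d , d∈ , sd , λ g const → trans (const c c∈ r≢x y≢x) (constancy g const)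

  parent : ∀ {T} → IsTree T → ∀ r x → r ≢ x → Parent T r x
  parent {T} (conn , _) r x r≢x with first-arrival (conn r x) r≢x
  ... | d , d∈ , refl , constancy = record
    { dart = d ; dart∈ = d∈ ; dart-src = refl ; separated = sep ; unseparated = unsep }
    where
    -- A dart that avoids `src d` is neither `c` nor its reverse, so `C` is constant along it.
    r~tgt : ∀ c (C : Cut T c) → src c ≡ src d → side C r ≡ side C (tgt d)
    r~tgt c C sc = constancy (side C) λ g g∈ sg tg →
      constant C g g∈ (λ { refl → sg sc }) (λ { refl → tg (trans (tgt-flip c) sc) })
    sep : ∀ c (C : Cut T c) → c ≡ d → side C (src d) ≢ side C r
    sep c C refl eq = separates C (trans eq (r~tgt c C refl))
    unsep : ∀ c (C : Cut T c) → src c ≡ src d → c ≢ d → side C (src d) ≡ side C r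
    unsep c C sc c≢d =
      trans (constant C d d∈ (c≢d ∘ sym) (λ { refl → src≢tgt c sc })) (sym (r~tgt c C sc))

  -- Exchanging two edges at a common node

  exchange : EdgeSet H → St H → St H → EdgeSet H
  exchange T d₀ d₁ = update (T ∖ d₀) d₁ true

  exchange-off : ∀ T d₀ d₁ c → c ≢ d₀ → c ≢ flip d₀ → c ≢ d₁ → c ≢ flip d₁ → has (exchange T d₀ d₁) c ≡ has T c
  exchange-off T d₀ d₁ c c≢d₀ c≢fd₀ c≢d₁ c≢fd₁ =
    trans (update-off (T ∖ d₀) d₁ true c c≢d₁ c≢fd₁) (update-off T d₀ false c c≢d₀ c≢fd₀)

  exchange-∈ : ∀ {T d₀ d₁ c} → c ∈ exchange T d₀ d₁ → (c ≡ d₁ ⊎ c ≡ flip d₁) ⊎ (c ∈ T × c ≢ d₀ × c ≢ flip d₀)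
  exchange-∈ {T} {d₀} {d₁} {c} c∈ with update-∈ (T ∖ d₀) d₁ true c c∈
  ... | inj₁ (_ , new)      = inj₁ new
  ... | inj₂ (c∈T∖d₀ , _) = inj₂ (∖-∈ {d = d₀} {c} c∈T∖d₀)

  exchange-new : ∀ T d₀ d₁ → d₁ ∈ exchange T d₀ d₁
  exchange-new T d₀ d₁ = update-at (T ∖ d₀) d₁ true

  ∖⊆exchange : ∀ T d₀ d₁ → (T ∖ d₀) ⊆ exchange T d₀ d₁
  ∖⊆exchange T d₀ d₁ c c∈ with c ≟ˢ d₁ | c ≟ˢ flip d₁
  ... | yes refl | _        = exchange-new T d₀ d₁
  ... | no _     | yes refl = update-flip (T ∖ d₀) d₁ true
  ... | no c≢d₁  | no c≢fd₁ = trans (update-off (T ∖ d₀) d₁ true c c≢d₁ c≢fd₁) c∈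

  module _ {T d₀ d₁} (tree : IsTree T) (same-src : src d₀ ≡ src d₁)
           (C : Cut T d₀) (d₁-crosses : side C (src d₁) ≢ side C (tgt d₁)) where

    private
      T′ = exchange T d₀ d₁

      lift : ∀ {x y} → Star (Adj H (T ∖ d₀)) x y → Star (Adj H T′) x y
      lift = walk-map (λ c c∈ → edge c (∖⊆exchange T d₀ d₁ c c∈))

      -- Without `d₀`, the node `tgt d₁` still reaches an end of `d₀`; its colour in `C` excludes
      -- the end shared with `d₁`.
      tgts-joined : Star (Adj H (T ∖ d₀)) (tgt d₁) (tgt d₀)
      tgts-joined with reach-end d₀ (proj₁ tree (tgt d₁) (src d₀))
      ... | inj₂ w = w
      ... | inj₁ w = contradiction
        (sym (trans (walk-constant (side C) (λ c c∈ → let c∈T , ≢d₀ , ≢fd₀ = ∖-∈ {d = d₀} {c} c∈ in constant C c c∈T ≢d₀ ≢fd₀) w)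
                    (cong (side C) same-src)))
        d₁-crosses

      detour : Star (Adj H T′) (src d₀) (tgt d₀)
      detour = subst (λ x → Star (Adj H T′) x (tgt d₁)) (sym same-src) (edge d₁ (exchange-new T d₀ d₁)) ◅◅ lift tgts-joined

    exchange-connected : ConnectedSub H T′
    exchange-connected x y = walk-map reroute (proj₁ tree x y)
      where
      reroute : ∀ c → c ∈ T → Star (Adj H T′) (src c) (tgt c)
      reroute c c∈ with c ≟ˢ d₀ | c ≟ˢ flip d₀
      ... | yes refl | _        = detour
      ... | no _     | yes refl = subst (Star (Adj H T′) (tgt d₀)) (sym (tgt-flip d₀)) (walk-sym detour)
      ... | no c≢d₀  | no c≢fd₀ = lift (edge c (∈-∖ {d = d₀} c∈ c≢d₀ c≢fd₀))

    private
      -- The colouring of the old cut serves again: `d₁` has replaced `d₀` as its only crossing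
      -- edge.
      cut-at-d₁ : Cut T′ d₁
      cut-at-d₁ = record { side = side C ; separates = d₁-crosses ; constant = const }
        where
        const : ∀ c → c ∈ T′ → c ≢ d₁ → c ≢ flip d₁ → side C (src c) ≡ side C (tgt c)
        const c c∈ c≢d₁ c≢fd₁ with exchange-∈ {T} {d₀} {d₁} {c} c∈
        ... | inj₁ (inj₁ eq) = contradiction eq c≢d₁
        ... | inj₁ (inj₂ eq) = contradiction eq c≢fd₁
        ... | inj₂ (c∈T , c≢d₀ , c≢fd₀) = constant C c c∈T c≢d₀ c≢fd₀

      ends-of-flip : ∀ (g : Node H → Bool) d → g (src d) ≡ g (tgt d) → g (src (flip d)) ≡ g (tgt (flip d))
      ends-of-flip g d eq = trans (sym eq) (cong g (sym (tgt-flip d)))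

      -- If the old cut at c happens to separate the ends of d₁, adding the cut at d₀
      -- (which separates them too) repairs it.
      cut-at-old : ∀ c → c ∈ T → c ≢ d₀ → c ≢ flip d₀ → Cut T′ c
      cut-at-old c c∈ c≢d₀ c≢fd₀ with proj₂ tree c c∈
      ... | C′ with side C′ (src d₁) Bool.≟ side C′ (tgt d₁)
      ...   | yes same = record { side = side C′ ; separates = separates C′ ; constant = const }
        where
        const : ∀ b → b ∈ T′ → b ≢ c → b ≢ flip c → side C′ (src b) ≡ side C′ (tgt b)
        const b b∈ b≢c b≢fc with exchange-∈ {T} {d₀} {d₁} {b} b∈
        ... | inj₁ (inj₁ refl) = same
        ... | inj₁ (inj₂ refl) = ends-of-flip (side C′) d₁ same
        ... | inj₂ (b∈T , _ , _) = constant C′ b b∈T b≢c b≢fc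
      ...   | no diff = record
        { side      = sum
        ; separates = xor-left-differs (separates C′) (constant C c c∈ c≢d₀ c≢fd₀)
        ; constant  = const }
        where
        sum : Node H → Bool
        sum x = side C′ x xor side C x
        new : sum (src d₁) ≡ sum (tgt d₁)
        new = xor-both-differ diff d₁-crosses
        const : ∀ b → b ∈ T′ → b ≢ c → b ≢ flip c → sum (src b) ≡ sum (tgt b)
        const b b∈ b≢c b≢fc with exchange-∈ {T} {d₀} {d₁} {b} b∈
        ... | inj₁ (inj₁ refl) = new
        ... | inj₁ (inj₂ refl) = ends-of-flip sum d₁ new
        ... | inj₂ (b∈T , b≢d₀ , b≢fd₀) =
          cong₂ _xor_ (constant C′ b b∈T b≢c b≢fc) (constant C b b∈T b≢d₀ b≢fd₀)

    exchange-tree : IsTree T′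
    exchange-tree = exchange-connected , cut
      where
      cut : ∀ c → c ∈ T′ → Cut T′ c
      cut c c∈ with exchange-∈ {T} {d₀} {d₁} {c} c∈
      ... | inj₁ (inj₁ refl) = cut-at-d₁
      ... | inj₁ (inj₂ refl) = cut-flip cut-at-d₁
      ... | inj₂ (c∈T , c≢d₀ , c≢fd₀) = cut-at-old c c∈T c≢d₀ c≢fd₀

  exchange-support : ∀ (T : EdgeSet H) (d₀ d₁ c : St H) → has T c ≢ has (exchange T d₀ d₁) c →
                     (c ≡ d₀ ⊎ c ≡ flip d₀) ⊎ (c ≡ d₁ ⊎ c ≡ flip d₁)
  exchange-support T d₀ d₁ c diff with c ≟ˢ d₀ | c ≟ˢ flip d₀ | c ≟ˢ d₁ | c ≟ˢ flip d₁
  ... | yes eq | _ | _ | _ = inj₁ (inj₁ eq)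
  ... | no _ | yes eq | _ | _ = inj₁ (inj₂ eq)
  ... | no _ | no _ | yes eq | _ = inj₂ (inj₁ eq)
  ... | no _ | no _ | no _ | yes eq = inj₂ (inj₂ eq)
  ... | no p | no q | no r | no s = contradiction (sym (exchange-off T d₀ d₁ c p q r s)) diff

  -- At `e` both edge sets have one edge more than `T ∖ atE e u`; other emerald nodes are not
  -- touched.
  exchange-degE : ∀ T e u v → T u e ≡ true → T v e ≡ false →
                  ∀ e′ → degE H (exchange T (atE e u) (atE e v)) e′ ≡ degE H T e′
  exchange-degE T e u v Tu Tv e′ = by-emerald (e′ Fin.≟ e)
    where
    by-emerald : Dec (e′ ≡ e) → degE H (exchange T (atE e u) (atE e v)) e′ ≡ degE H T e′
    by-emerald (no e′≢e) = countTrue-cong λ w →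
     exchange-off T (atE e u) (atE e v) (atE e′ w) (λ { refl → e′≢e refl }) (λ ()) (λ { refl → e′≢e refl }) (λ ())
    by-emerald (yes refl) = trans
     (countTrue-insert (λ w → (T ∖ atE e u) w e) (λ w → exchange T (atE e u) (atE e v) w e) v
       (trans (update-off T (atE e u) false (atE e v) (λ { refl → true≢false (trans (sym Tu) Tv) }) (λ ())) Tv)
       (exchange-new T (atE e u) (atE e v))
       (λ w w≢v → sym (update-off (T ∖ atE e u) (atE e v) true (atE e w) (λ { refl → w≢v refl }) (λ ()))))
     (sym (countTrue-insert (λ w → (T ∖ atE e u) w e) (λ w → T w e) u
       (update-at T (atE e u) false) Tu
       (λ w w≢u → update-off T (atE e u) false (atE e w) (λ { refl → w≢u refl }) (λ ()))))

open Cut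
open Parent

-- Numbering the tour states

module _ (H : Hypergraph) where

  dart-bound : ℕ
  dart-bound = m H * n H + n H * m H

  code : St H → Fin (m H * n H) ⊎ Fin (n H * m H)
  code (atV v e) = inj₁ (combine v e)
  code (atE e v) = inj₂ (combine e v)

  code-injective : ∀ c d → code c ≡ code d → c ≡ d
  code-injective (atV v e) (atV v′ e′) eq
    with refl , refl ← Fin.combine-injective v e v′ e′ (inj₁-injective eq) = refl
  code-injective (atE e v) (atE e′ v′) eq
    with refl , refl ← Fin.combine-injective e v e′ v′ (inj₂-injective eq) = refl

  encode : St H → Fin dart-bound
  encode d = join (m H * n H) (n H * m H) (code d)

  encode-injective : ∀ c d → encode c ≡ encode d → c ≡ d
  encode-injective c d eq = code-injective c d (join-injective (m H * n H) (n H * m H) eq)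

-- Rotation and the tour step

module _ {H : Hypergraph} (ρ : Ribbon H) where

  -- Both successor maps of the ribbon structure as one map on darts; a tour step is `rot`, preceded
  -- by `flip` on tree edges.
  rot : St H → St H
  rot (atV v e) = atV v (σV ρ v e)
  rot (atE e v) = atE e (σE ρ e v)

  src-rot : ∀ d → src (rot d) ≡ src d
  src-rot (atV v e) = refl
  src-rot (atE e v) = refl

  rot-inc : ∀ d → d ∈ inc H → rot d ∈ inc H
  rot-inc (atV v e) = σV-inc ρ v e
  rot-inc (atE e v) = σE-inc ρ e v

  rot-cyclic : ∀ c d → c ∈ inc H → d ∈ inc H → src c ≡ src d → Σ ℕ λ k → iter rot k c ≡ d
  rot-cyclic (atV v e) (atV .v e′) c∈ d∈ refl =
    let k , eq = σV-cyc ρ v e e′ c∈ d∈ in k , trans (iter-rot k) (cong (atV v) eq)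
    where
    iter-rot : ∀ k → iter rot k (atV v e) ≡ atV v (iter (σV ρ v) k e)
    iter-rot zero    = refl
    iter-rot (suc k) = cong rot (iter-rot k)
  rot-cyclic (atE e v) (atE .e v′) c∈ d∈ refl =
    let k , eq = σE-cyc ρ e v v′ c∈ d∈ in k , trans (iter-rot k) (cong (atE e) eq)
    where
    iter-rot : ∀ k → iter rot k (atE e v) ≡ atE e (iter (σE ρ e) k v)
    iter-rot zero    = refl
    iter-rot (suc k) = cong rot (iter-rot k)

  -- Cyclicity leads from `rot c` back to `c`, so every incident dart is periodic and
  -- `preimage-unique` applies.
  rot-injective : ∀ c d → c ∈ inc H → d ∈ inc H → rot c ≡ rot d → c ≡ d
  rot-injective c d c∈ d∈ eq =
    let a , ya = rot-cyclic (rot c) c (rot-inc c c∈) c∈ (src-rot c)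
        b , zb = rot-cyclic (rot d) d (rot-inc d d∈) d∈ (src-rot d)
    in preimage-unique rot a b ya zb eq

  step-∈ : ∀ {T} d → d ∈ T → step H ρ T d ≡ rot (flip d)
  step-∈ (atV v e) d∈ rewrite d∈ = refl
  step-∈ (atE e v) d∈ rewrite d∈ = refl

  step-∉ : ∀ {T} d → d ∉ T → step H ρ T d ≡ rot d
  step-∉ (atV v e) d∉ rewrite d∉ = refl
  step-∉ (atE e v) d∉ rewrite d∉ = refl

  step-cong : ∀ {T T′} d → has T d ≡ has T′ d → step H ρ T d ≡ step H ρ T′ d
  step-cong (atV v e) eq rewrite eq = refl
  step-cong (atE e v) eq rewrite eq = refl

  data StepView (T : EdgeSet H) (d : St H) : Set where
    traverse : d ∈ T → step H ρ T d ≡ rot (flip d) → StepView T d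
    skip     : d ∉ T → step H ρ T d ≡ rot d → StepView T d

  stepView : ∀ T d → StepView T d
  stepView T d with has T d in eq
  ... | true  = traverse eq (step-∈ d eq)
  ... | false = skip eq (step-∉ d eq)

  step-inc : ∀ T d → d ∈ inc H → step H ρ T d ∈ inc H
  step-inc T d d∈ with stepView T d
  ... | traverse _ eq rewrite eq = rot-inc (flip d) (∈-flip {d = d} d∈)
  ... | skip _ eq     rewrite eq = rot-inc d d∈

  -- After undoing `rot`, the resulting dart tells whether it was flipped: both darts of an edge
  -- agree on membership in `T`.
  step-injective : ∀ T c d → c ∈ inc H → d ∈ inc H → step H ρ T c ≡ step H ρ T d → c ≡ d
  step-injective T c d c∈ d∈ eq with stepView T c | stepView T d
  ... | traverse _ p | traverse _ q =
    trans (sym (flip-involutive c)) (trans (cong flip (rot-injective (flip c) (flip d) (∈-flip {d = c} c∈) (∈-flip {d = d} d∈)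
      (trans (sym p) (trans eq q)))) (flip-involutive d))
  ... | skip _ p | skip _ q = rot-injective c d c∈ d∈ (trans (sym p) (trans eq q))
  ... | traverse c∈T p | skip d∉T q = contradiction
    (rot-injective (flip c) d (∈-flip {d = c} c∈) d∈ (trans (sym p) (trans eq q)))
    (∉⇒≢ {c = flip c} (∈-flip {d = c} c∈T) d∉T)
  ... | skip c∉T p | traverse d∈T q = contradiction
    (sym (rot-injective c (flip d) c∈ (∈-flip {d = d} d∈) (trans (sym p) (trans eq q))))
    (∉⇒≢ {c = flip d} (∈-flip {d = d} d∈T) c∉T)

-- How a tour moves through a tree

module _ {H : Hypergraph} (ρ : Ribbon H) (s₀ : St H) (s₀∈ : s₀ ∈ inc H) where

  private
    τ : EdgeSet H → ℕ → St H
    τ T k = tourAt H ρ T s₀ k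

  Fresh : EdgeSet H → ℕ → Set
  Fresh T j = ∀ k → 0 < k → k ≤ j → τ T k ≢ s₀

  tour-inc : ∀ T k → τ T k ∈ inc H
  tour-inc T zero    = s₀∈
  tour-inc T (suc k) = step-inc ρ T (τ T k) (tour-inc T k)

  -- Injectivity of the step lets the tour be run backwards, so any repetition of a state forces a
  -- return to `s₀`.
  tour-cancel : ∀ T i k → τ T (i + k) ≡ τ T i → τ T k ≡ s₀
  tour-cancel T zero    k eq = eq
  tour-cancel T (suc i) k eq =
    tour-cancel T i k (step-injective ρ T _ _ (tour-inc T (i + k)) (tour-inc T i) eq)

  fresh-distinct : ∀ {T a b j} → Fresh T j → a < b → b ≤ j → τ T a ≢ τ T b
  fresh-distinct {T} {a} {b} fresh a<b b≤j eq =
    fresh (b ∸ a) (m<n⇒0<n∸m a<b) (≤-trans (m∸n≤m b a) b≤j)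
      (tour-cancel T a (b ∸ a) (trans (cong (τ T) (m+[n∸m]≡n (<⇒≤ a<b))) (sym eq)))

  -- Rotation keeps the node, so the colour changes only when an edge of `T` is traversed. That edge
  -- must be the one of `d`, and the colours fix its direction.
  tour-crosses : ∀ {T d} (C : Cut T d) a b → a ≤ b →
    side C (src (τ T a)) ≡ side C (src d) → side C (src (τ T b)) ≡ side C (tgt d) →
    Σ ℕ λ c → a ≤ c × c < b × τ T c ≡ d
  tour-crosses {T} {d} C a b a≤b at-src at-tgt
    with switch (side C ∘ src ∘ τ T) a b a≤b (λ eq → separates C (trans (sym at-src) (trans eq at-tgt)))
  ... | c , a≤c , c<b , before , after = c , a≤c , c<b , here-is-d
    where
    at-c : side C (src (τ T c)) ≡ side C (src d)
    at-c = trans before at-src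
    past-c : side C (src (step H ρ T (τ T c))) ≡ side C (tgt d)
    past-c = trans after at-tgt
    here-is-d : τ T c ≡ d
    here-is-d with stepView ρ T (τ T c)
    ... | skip _ eq = contradiction
      (trans (sym at-c) (trans (cong (side C) (sym (trans (cong src eq) (src-rot ρ (τ T c))))) past-c)) (separates C)
    ... | traverse c∈ eq with crossing C (τ T c) c∈
            (λ same → separates C (trans (sym at-c) (trans same
              (trans (cong (side C) (sym (trans (cong src eq) (src-rot ρ (flip (τ T c)))))) past-c))))
    ...   | inj₁ τc≡d  = τc≡d
    ...   | inj₂ τc≡fd = contradiction (trans (sym at-c) (cong (side C ∘ src) τc≡fd)) (separates C)

  -- After traversing a tree edge, the tour can return to the node only through the reversed dart,
  -- and the step from there is the next rotation.
  next-visit : ∀ {T} → IsTree T → ∀ a b → a < b → src (τ T b) ≡ src (τ T a) →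
               Σ ℕ λ c → a < c × c ≤ b × τ T c ≡ rot ρ (τ T a)
  next-visit {T} (_ , cuts) a b a<b same with stepView ρ T (τ T a)
  ... | skip _ eq      = suc a , ≤-refl , a<b , eq
  ... | traverse a∈ eq
    with tour-crosses (cut-flip (cuts (τ T a) a∈)) (suc a) b a<b
           (cong (side C) (trans (cong src eq) (src-rot ρ (flip (τ T a)))))
           (cong (side C) (trans same (sym (tgt-flip (τ T a)))))
    where
    C : Cut T (τ T a)
    C = cuts (τ T a) a∈
  ... | c , a<c , c<b , back = suc c , ≤-trans a<c (n≤1+n c) , c<b ,
    trans (cong (step H ρ T) back)
      (trans (step-∈ ρ (flip (τ T a)) (∈-flip {d = τ T a} a∈)) (cong (rot ρ) (flip-involutive (τ T a))))

  -- Pigeonhole among the first `dart-bound H + 1` states gives a repetition, which `tour-cancel`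
  -- turns into a return to `s₀`. The first return is at time `suc p`.
  period : ∀ T → Σ ℕ λ p → p < dart-bound H × τ T (suc p) ≡ s₀ × Fresh T p
  period T with Fin.pigeonhole (n<1+n (dart-bound H)) (λ i → encode H (τ T (toℕ i)))
  ... | i , j , i<j , eq
    with least (λ k → τ T (suc k) ≡ s₀) (λ k → τ T (suc k) ≟ˢ s₀) (toℕ j ∸ suc (toℕ i))
           (tour-cancel T (toℕ i) _ (trans (cong (τ T) (trans (+-suc (toℕ i) _) (m+[n∸m]≡n i<j)))
             (sym (encode-injective H _ _ eq))))
  ... | p , p≤ , recurs , before =
    p , <-≤-trans (≤-trans (s≤s (≤-trans p≤ (m≤n+m _ (toℕ i)))) (≤-reflexive (m+[n∸m]≡n i<j))) (s≤s⁻¹ (Fin.toℕ<n j)) , recurs ,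
    λ { (suc k) _ k<p → before k k<p }

  -- Visited darts are closed under rotation and under crossing edges of `T`; connectivity of `T`
  -- spreads them to every node.
  tour-complete : ∀ {T p} → IsTree T → T ⊆ inc H → τ T (suc p) ≡ s₀ →
                  ∀ d → d ∈ inc H → Σ ℕ λ k → k ≤ p × τ T k ≡ d
  tour-complete {T} {p} tree T⊆ recurs d d∈ with everywhere (proj₁ tree (src s₀) (src d)) (λ c c∈ sc → around s₀ c (0 , refl) s₀∈ c∈ (sym sc)) d d∈ refl
    where
    Visited : St H → Set
    Visited d = Σ ℕ λ k → τ T k ≡ d
    rotate : ∀ d → Visited d → Visited (rot ρ d)
    rotate d (a , refl) =
      -- One period later the tour is at the same node again, as `next-visit` requires.
      let later : τ T (suc p + a) ≡ τ T a
          later = trans (cong (τ T) (+-comm (suc p) a)) (trans (iter-+ (step H ρ T) a (suc p) s₀) (cong (iter (step H ρ T) a) recurs))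
          c , _ , _ , eq = next-visit tree a (suc p + a) (s≤s (m≤n+m a p)) (cong src later)
      in c , eq
    rotate-iter : ∀ k d → Visited d → Visited (iter (rot ρ) k d)
    rotate-iter zero    d vis = vis
    rotate-iter (suc k) d vis = rotate _ (rotate-iter k d vis)
    around : ∀ c d → Visited c → c ∈ inc H → d ∈ inc H → src c ≡ src d → Visited d
    around c d vis c∈ d∈ sc with rot-cyclic ρ c d c∈ d∈ sc
    ... | k , refl = rotate-iter k c vis
    across : ∀ d → d ∈ T → Visited d → Visited (rot ρ (flip d))
    across d d∈T (k , refl) = suc k , step-∈ ρ (τ T k) d∈T
    everywhere : ∀ {x y} → Star (Adj H T) x y → (∀ c → c ∈ inc H → src c ≡ x → Visited c) →
                 ∀ c → c ∈ inc H → src c ≡ y → Visited c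
    everywhere ε vis = vis
    everywhere (_◅_ {x} {y} a w) vis with adj⇒dart x y a
    ... | g , g∈ , refl , refl = everywhere w λ c c∈ sc →
      around (rot ρ (flip g)) c (across g g∈ (vis g (T⊆ g g∈) refl))
        (rot-inc ρ (flip g) (∈-flip {d = g} (T⊆ g g∈))) c∈ (trans (src-rot ρ (flip g)) (sym sc))
  ... | k , τk≡d = k % suc p , s≤s⁻¹ (m%n<n k (suc p)) , (begin
    τ T (k % suc p)                                ≡⟨ cong (iter (step H ρ T) (k % suc p)) (iter-period (step H ρ T) (suc p) s₀ recurs (k / suc p)) ⟨
    iter (step H ρ T) (k % suc p) (τ T (k / suc p * suc p)) ≡⟨ iter-+ (step H ρ T) (k % suc p) _ s₀ ⟨
    τ T (k % suc p + k / suc p * suc p)            ≡⟨ cong (τ T) (m≡m%n+[m/n]*n k (suc p)) ⟨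
    τ T k                                          ≡⟨ τk≡d ⟩
    d                                              ∎)
    where open ≡-Reasoning

  -- A step consults the tree only about the current edge, so the tours coincide until the trees
  -- first disagree on one.
  first-difference : ∀ T T′ i → has T (τ T i) ≢ has T′ (τ T i) →
    Σ ℕ λ t → t ≤ i × has T (τ T t) ≢ has T′ (τ T t) ×
      (∀ k → k < t → has T (τ T k) ≡ has T′ (τ T k)) × (∀ k → k ≤ t → τ T′ k ≡ τ T k)
  first-difference T T′ i diff
    with least (λ k → has T (τ T k) ≢ has T′ (τ T k)) (λ k → ¬? (has T (τ T k) Bool.≟ has T′ (τ T k))) i diff
  ... | t , t≤i , diff-t , before = t , t≤i , diff-t , agree , same-tour
    where
    agree : ∀ k → k < t → has T (τ T k) ≡ has T′ (τ T k)
    agree k k<t = decidable-stable (has T (τ T k) Bool.≟ has T′ (τ T k)) (before k k<t)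
    same-tour : ∀ k → k ≤ t → τ T′ k ≡ τ T k
    same-tour zero    _   = refl
    same-tour (suc k) k<t =
      trans (cong (step H ρ T′) (same-tour k (<⇒≤ k<t))) (sym (step-cong ρ (τ T k) (agree k k<t)))

  -- Greedy words and the improving exchange

  greedy : EdgeSet H → St H → Bool
  greedy T (atV v e) = T v e
  greedy T (atE e v) = not (T v e)

  greedy-cong : ∀ {T T′} d → has T d ≡ has T′ d → greedy T d ≡ greedy T′ d
  greedy-cong (atV v e) eq = eq
  greedy-cong (atE e v) eq = cong not eq

  -- Second meetings of an edge are recorded too. This is harmless: two words first differ at a
  -- first meeting, as the trees agree on all edges met before.
  greedy-word : EdgeSet H → ℕ → Bool
  greedy-word T k = greedy T (τ T k)

  -- Suppose the tour meets d₀ first from its far end and later returns to the near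
  -- side by d₀ itself. In between it visits every dart at src d₀.
  sweep : ∀ {T} → IsTree T → ∀ {d₀} → d₀ ∈ T → ∀ t u → t < u → τ T t ≡ flip d₀ → τ T u ≡ d₀ →
          ∀ k → Σ ℕ λ c → t < c × c ≤ u × τ T c ≡ iter (rot ρ) (suc k) d₀
  sweep {T} tree {d₀} d₀∈ t u t<u at-t at-u = visit
    where
    at-1+t : τ T (suc t) ≡ rot ρ d₀
    at-1+t = trans (cong (step H ρ T) at-t)
      (trans (step-∈ ρ {T = T} (flip d₀) (∈-flip {d = d₀} d₀∈)) (cong (rot ρ) (flip-involutive d₀)))
    src-iter : ∀ k → src (iter (rot ρ) k d₀) ≡ src d₀
    src-iter zero    = refl
    src-iter (suc k) = trans (src-rot ρ (iter (rot ρ) k d₀)) (src-iter k)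
    visit : ∀ k → Σ ℕ λ c → t < c × c ≤ u × τ T c ≡ iter (rot ρ) (suc k) d₀
    visit zero = suc t , ≤-refl , t<u , at-1+t
    visit (suc k) with visit k
    ... | c , t<c , c≤u , at-c with m≤n⇒m<n∨m≡n c≤u
    -- The rotation has come full circle to `d₀`; the next dart is the one visited right after time
    -- `t`.
    ...   | inj₂ refl = suc t , ≤-refl , t<u , trans at-1+t (cong (rot ρ) (trans (sym at-u) at-c))
    ...   | inj₁ c<u with next-visit tree c u c<u
                (trans (cong src at-u) (sym (trans (cong src at-c) (src-iter (suc k)))))
    ...     | c′ , c<c′ , c′≤u , at-c′ = c′ , ≤-trans t<c (<⇒≤ c<c′) , c′≤u , trans at-c′ (cong (rot ρ) at-c)

  Improvement : (T : EdgeSet H) → ℕ → Set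
  Improvement T i = Σ (EdgeSet H) λ T′ →
    _⊆_ {H} T′ (inc H) × IsTree {H} T′ × (∀ e → degE H T′ e ≡ degE H T e) ×
    Σ ℕ λ t → t ≤ i × (∀ k → k < t → greedy-word T k ≡ greedy-word T′ k) ×
      greedy-word T t ≡ false × greedy-word T′ t ≡ true

  -- The edge to remove is the parent edge of `e` towards `v`; its cut separates `e` from `v`, so
  -- exchanging it for `ve` yields a tree.
  improve : ∀ {T} → _⊆_ {H} T (inc H) → IsTree {H} T → ∀ v e → inc H v e ≡ true → T v e ≡ false →
            ∀ i j → i < j → Fresh T j → τ T i ≡ atV v e → τ T j ≡ atE e v → Improvement T i
  improve {T} T⊆ tree v e ve∈ ve∉ i j i<j fresh at-i at-j with parent tree (inj₁ v) (inj₂ e) (λ ())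
  ... | P@(record { dart = atE .e u ; dart∈ = d₀∈ ; dart-src = refl }) =
    T′ , T′⊆ , T′-tree , exchange-degE {H} T e u v d₀∈ ve∉ , improvement
    where
    d₀ d₁ : St H
    d₀ = atE e u
    d₁ = atE e v
    T′ : EdgeSet H
    T′ = exchange T d₀ d₁
    C : Cut T d₀
    C = proj₂ tree d₀ d₀∈
    d₁-crosses : side C (inj₂ e) ≢ side C (inj₁ v)
    d₁-crosses = separated P d₀ C refl
    T′-tree : IsTree {H} T′
    T′-tree = exchange-tree tree refl C d₁-crosses
    T′⊆ : _⊆_ {H} T′ (inc H)
    T′⊆ c c∈ with exchange-∈ {T = T} {d₀} {d₁} {c} c∈
    ... | inj₁ (inj₁ refl)  = ve∈
    ... | inj₁ (inj₂ refl)  = ve∈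
    ... | inj₂ (c∈T , _)    = T⊆ c c∈T
    d₀≢d₁ : d₀ ≢ d₁
    d₀≢d₁ = ∉⇒≢ {R = T} d₀∈ ve∉
    d₁∈T′ : d₁ ∈ T′
    d₁∈T′ = exchange-new T d₀ d₁
    d₀∉T′ : d₀ ∉ T′
    d₀∉T′ = trans (update-off (T ∖ d₀) d₁ true d₀ d₀≢d₁ (λ ())) (update-at T d₀ false)
    not-seen : ∀ c → c ≤ i → τ T c ≢ d₁
    not-seen c c≤i eq = fresh-distinct fresh (≤-<-trans c≤i i<j) ≤-refl (trans eq (sym at-j))
    -- Otherwise the tour would have swept all darts at e, d₁ among them, by time i.
    d₀-met-first-at-e : ∀ t → t ≤ i → τ T t ≢ flip d₀
    d₀-met-first-at-e t t≤i at-t = excluded (m≤n⇒m<n∨m≡n t≤i)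
      where
      excluded : t < i ⊎ t ≡ i → ⊥
      excluded (inj₂ refl) = d₀≢d₁ (cong flip (trans (sym at-t) at-i))
      excluded (inj₁ t<i) with tour-crosses C (suc t) i t<i
        (cong (side C ∘ src) (trans (cong (step H ρ T) at-t) (step-∈ ρ {T = T} (flip d₀) d₀∈)))
        (trans (cong (side C ∘ src) at-i) (≢⇒both≡ (d₁-crosses ∘ sym) (separates C ∘ sym)))
      ... | c , t<c , c<i , at-c with rot-cyclic ρ d₀ d₁ (T⊆ d₀ d₀∈) ve∈ refl
      ...   | zero  , eq = d₀≢d₁ eq
      ...   | suc k , eq with sweep tree d₀∈ t c t<c at-t at-c k
      ...     | c′ , _ , c′≤c , at-c′ = not-seen c′ (≤-trans c′≤c (<⇒≤ c<i)) (trans at-c′ eq)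
    -- Of the four darts where the trees can differ, `d₁` and `flip d₀` are excluded; at the other
    -- two only `T′` grants the wish.
    better : ∀ t → t ≤ i → τ T′ t ≡ τ T t → (τ T t ≡ d₀ ⊎ τ T t ≡ flip d₀) ⊎ (τ T t ≡ d₁ ⊎ τ T t ≡ flip d₁) →
             greedy-word T t ≡ false × greedy-word T′ t ≡ true
    better t t≤i same (inj₂ (inj₁ at-t)) = contradiction at-t (not-seen t t≤i)
    better t t≤i same (inj₂ (inj₂ at-t)) =
      trans (cong (greedy T) at-t) ve∉ , trans (cong (greedy T′) (trans same at-t)) d₁∈T′
    better t t≤i same (inj₁ (inj₁ at-t)) =
      trans (cong (greedy T) at-t) (cong not d₀∈) , trans (cong (greedy T′) (trans same at-t)) (cong not d₀∉T′)
    better t t≤i same (inj₁ (inj₂ at-t)) = contradiction at-t (d₀-met-first-at-e t t≤i)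
    improvement : Σ ℕ λ t → t ≤ i × (∀ k → k < t → greedy-word T k ≡ greedy-word T′ k) ×
                    greedy-word T t ≡ false × greedy-word T′ t ≡ true
    improvement
      -- At time `i` the tour is at `ve`, which lies in `T′` only, so a difference occurs by then.
      with first-difference T T′ i (λ eq → true≢false
             (trans (sym d₁∈T′) (trans (sym (subst (λ d → has T d ≡ has T′ d) at-i eq)) ve∉)))
    ... | t , t≤i , diff , agree , same-tour =
      t , t≤i ,
      (λ k k<t → trans (greedy-cong (τ T k) (agree k k<t)) (cong (greedy T′) (sym (same-tour k (<⇒≤ k<t))))) ,
      better t t≤i (same-tour t ≤-refl) (exchange-support T d₀ d₁ (τ T t) diff)

  -- Existence

  CutsAtEmerald : EdgeSet H → Set
  CutsAtEmerald T = ∀ v e → inc H v e ≡ true → T v e ≡ false → Precedes H ρ T s₀ (atE e v) (atV v e)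

  module _ (f : Fin (n H) → ℕ) where

    Realizes : EdgeSet H → Set
    Realizes T = _⊆_ {H} T (inc H) × IsTree {H} T × (∀ e → degE H T e ≡ f e + 1)

    value : EdgeSet H → ℕ
    value T = binary (dart-bound H) (greedy-word T)

    -- Each non-edge is met at both ends within one period; the order of the two meetings decides
    -- between a cut at the emerald end and an exchange.
    jaeger-or-improve : ∀ T → Realizes T →
      CutsAtEmerald T ⊎ Σ (EdgeSet H) λ T′ → Realizes T′ × value T < value T′
    jaeger-or-improve T (T⊆ , tree , deg) with period T
    ... | p , p<N , recurs , fresh = map₂ proj₂ (Fin-all⊎any λ v → map₂ proj₂ (Fin-all⊎any (at v)))
      where
      Better : Set
      Better = Σ (EdgeSet H) λ T′ → Realizes T′ × value T < value T′
      Cuts : Fin (m H) → Fin (n H) → Set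
      Cuts v e = inc H v e ≡ true → T v e ≡ false → Precedes H ρ T s₀ (atE e v) (atV v e)
      at : ∀ v e → Cuts v e ⊎ Better
      at v e with inc H v e Bool.≟ true | T v e Bool.≟ false
      ... | no ∉inc | _ = inj₁ λ ∈inc → contradiction ∈inc ∉inc
      ... | yes _ | no ∈T = inj₁ λ _ ∉T → contradiction ∉T ∈T
      ... | yes ∈inc | yes ∉T
        with tour-complete tree T⊆ recurs (atV v e) ∈inc | tour-complete tree T⊆ recurs (atE e v) ∈inc
      ...   | i , i≤p , at-i | j , j≤p , at-j with <-cmp i j
      ...     | tri> _ _ j<i = inj₁ λ _ _ → j , i , j<i , at-j , at-i , λ k 0<k k≤i → fresh k 0<k (≤-trans k≤i i≤p)
      ...     | tri≈ _ refl _ with trans (sym at-i) at-j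
      ...       | ()
      at v e | yes ∈inc | yes ∉T | i , i≤p , at-i | j , j≤p , at-j | tri< i<j _ _
        with improve T⊆ tree v e ∈inc ∉T i j i<j (λ k 0<k k≤j → fresh k 0<k (≤-trans k≤j j≤p)) at-i at-j
      ... | T′ , T′⊆ , T′-tree , same-deg , t , t≤i , same-word , Tt , T′t = inj₂
        ( T′ , (T′⊆ , T′-tree , λ e → trans (same-deg e) (deg e))
        , binary-mono (dart-bound H) (greedy-word T) (greedy-word T′) t
            -- The first difference lies within one period, hence among the digits of the word.
            (≤-<-trans (≤-trans t≤i i≤p) p<N) same-word Tt T′t )

    -- Each exchange raises the value by at least one, and the value stays below `2 ^ dart-bound H`;
    -- `fuel` bounds the room left.
    jaeger-exists : ∀ fuel T → Realizes T → 2 ^ dart-bound H ≤ value T + fuel →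
      Σ (EdgeSet H) λ T′ → Realizes T′ × CutsAtEmerald T′
    jaeger-exists fuel T real enough with jaeger-or-improve T real
    ... | inj₁ cuts = T , real , cuts
    jaeger-exists zero T real enough | inj₂ _ = contradiction
      (<-≤-trans (binary<2^ (dart-bound H) (greedy-word T)) (≤-trans enough (≤-reflexive (+-identityʳ _)))) (<-irrefl refl)
    jaeger-exists (suc fuel) T real enough | inj₂ (T′ , real′ , T<T′) = jaeger-exists fuel T′ real′
      (≤-trans enough (≤-trans (≤-reflexive (+-suc (value T) fuel)) (+-monoˡ-≤ fuel T<T′)))

  -- Uniqueness: counting on one side of a cut

  -- Among the darts leaving a node, only the parent dart towards `r` has a cut separating that node
  -- from `r`.
  separator-unique : ∀ {T} → IsTree {H} T → ∀ r c c′ → c ∈ T → c′ ∈ T → src c ≡ src c′ →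
    (C : Cut T c) (C′ : Cut T c′) → side C (src c) ≢ side C r → side C′ (src c′) ≢ side C′ r → c ≡ c′
  separator-unique tree r c c′ c∈ c′∈ same C C′ sep sep′ =
    trans (is-parent c refl C sep) (sym (is-parent c′ (sym same) C′ sep′))
    where
    P : Parent _ r (src c)
    P = parent tree r (src c) (λ r≡ → sep (cong (side C) (sym r≡)))
    is-parent : ∀ b → src b ≡ src c → (B : Cut _ b) → side B (src b) ≢ side B r → b ≡ dart P
    is-parent b sb B sep-b = decidable-stable (b ≟ˢ dart P) λ b≢ →
      sep-b (trans (cong (side B) sb) (unseparated P b B sb b≢))

  violet : St H → Fin (m H)
  violet (atV v e) = v
  violet (atE e v) = v

  emerald : St H → Fin (n H)
  emerald (atV v e) = e
  emerald (atE e v) = e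

  has-ends : ∀ (T : EdgeSet H) d → T (violet d) (emerald d) ≡ has T d
  has-ends T (atV v e) = refl
  has-ends T (atE e v) = refl

  same-ends : ∀ c d → violet c ≡ violet d → emerald c ≡ emerald d → c ≡ d ⊎ c ≡ flip d
  same-ends (atV v e) (atV _ _) refl refl = inj₁ refl
  same-ends (atV v e) (atE _ _) refl refl = inj₂ refl
  same-ends (atE e v) (atV _ _) refl refl = inj₂ refl
  same-ends (atE e v) (atE _ _) refl refl = inj₁ refl

  -- Were `x` and `y` opposite ends of one edge, its cut would separate both from `r` and hence not
  -- from each other.
  parent-injective : ∀ {T r x y} → IsTree {H} T → (P : Parent T r x) (Q : Parent T r y) →
    violet (dart P) ≡ violet (dart Q) → emerald (dart P) ≡ emerald (dart Q) → x ≡ y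
  parent-injective {T} {r} {x} {y} tree P Q vs es with same-ends (dart P) (dart Q) vs es
  ... | inj₁ eq = trans (sym (dart-src P)) (trans (cong src eq) (dart-src Q))
  ... | inj₂ eq = contradiction
    (trans (cong (side C) (dart-src P))
      (trans (≢⇒both≡ (separated P (dart P) C refl) (separated Q (flip (dart P)) (cut-flip C) flipped))
             (cong (side C) (trans (sym (dart-src Q)) (cong src (sym flipped))))))
    (separates C)
    where
    C : Cut T (dart P)
    C = proj₂ tree (dart P) (dart∈ P)
    flipped : flip (dart P) ≡ dart Q
    flipped = trans (cong flip eq) (flip-involutive (dart Q))

  no-self-map-avoiding : (γ : Node H → Node H) → (∀ x y → γ x ≡ γ y → x ≡ y) → ∀ r → ¬ (∀ x → γ x ≢ r)
  no-self-map-avoiding γ γ-injective r missed = injection-hits γ′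
    (λ {i} {j} eq → splitAt-injective i j (γ-injective _ _ (join-injective (m H) (n H) eq)))
    (join (m H) (n H) r)
    (λ i eq → missed (splitAt (m H) i) (sym (join-injective (m H) (n H) eq)))
    where
    γ′ : Fin (m H + n H) → Fin (m H + n H)
    γ′ i = join (m H) (n H) (γ (splitAt (m H) i))
    splitAt-injective : ∀ i j → splitAt (m H) {n H} i ≡ splitAt (m H) j → i ≡ j
    splitAt-injective i j eq = trans (sym (Fin.join-splitAt (m H) (n H) i))
      (trans (cong (join (m H) (n H)) eq) (Fin.join-splitAt (m H) (n H) j))

  -- Let X be the side of e in T, and suppose T′ has no edge from an emerald node of
  -- X to a violet node outside. In T the edges with emerald end in X are the parent
  -- edges (towards v) of the nodes of X; in T′ they lie inside X, so they are
  -- parent edges (towards e) of nodes of X other than e. As T has at most as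
  -- many of them as T′, X injects into X minus e.
  cut-count : ∀ {T T′} → IsTree {H} T → IsTree {H} T′ → (∀ e → degE H T e ≤ degE H T′ e) →
    ∀ e v → T v e ≡ true → (C : Cut {H} T (atE e v)) →
    ¬ (∀ v₁ e₁ → side C (inj₂ e₁) ≡ side C (inj₂ e) → T′ v₁ e₁ ≡ true → side C (inj₁ v₁) ≡ side C (inj₂ e))
  cut-count {T} {T′} tree tree′ deg≤ e v d∈ C closed =
    no-self-map-avoiding γ γ-injective r γ-avoids
    where
    r : Node H
    r = inj₂ e
    φ : ∀ e₁ v₁ → T v₁ e₁ ≡ true → Fin (m H)
    φ e₁ = proj₁ (countTrue-≤⇒injection (λ w → T w e₁) (λ w → T′ w e₁) (deg≤ e₁))
    φ-∈ : ∀ e₁ v₁ h → T′ (φ e₁ v₁ h) e₁ ≡ true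
    φ-∈ e₁ = proj₁ (proj₂ (countTrue-≤⇒injection (λ w → T w e₁) (λ w → T′ w e₁) (deg≤ e₁)))
    φ-injective : ∀ e₁ v₁ v₂ h₁ h₂ → φ e₁ v₁ h₁ ≡ φ e₁ v₂ h₂ → v₁ ≡ v₂
    φ-injective e₁ = proj₂ (proj₂ (countTrue-≤⇒injection (λ w → T w e₁) (λ w → T′ w e₁) (deg≤ e₁)))

    -- The parent edge of `x` in `T` and its partner under `φ` in `T′`, the latter directed towards
    -- `r`: its source is the new image of `x`.
    record Child (x : Node H) : Set where
      field
        up        : Parent T (inj₁ v) x
        down      : St H
        down∈     : down ∈ T′
        D         : Cut T′ down
        sep       : side D (src down) ≢ side D r
        down-in   : side C (src down) ≡ side C r
        up∈       : T (violet (dart up)) (emerald (dart up)) ≡ true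
        emeralds  : emerald down ≡ emerald (dart up)
        violets   : violet down ≡ φ (emerald (dart up)) (violet (dart up)) up∈
    open Child

    child : ∀ x → side C x ≡ side C r → Child x
    child x x∈X = go (side D₀ (inj₂ e₁) Bool.≟ side D₀ r)
      where
      P : Parent T (inj₁ v) x
      P = parent tree (inj₁ v) x (λ { refl → separates C (sym x∈X) })
      v₁ : Fin (m H)
      v₁ = violet (dart P)
      e₁ : Fin (n H)
      e₁ = emerald (dart P)
      P∈ : T v₁ e₁ ≡ true
      P∈ = trans (has-ends T (dart P)) (dart∈ P)
      v₂ : Fin (m H)
      v₂ = φ e₁ v₁ P∈
      e₁∈X : side C (inj₂ e₁) ≡ side C r
      e₁∈X = emerald-in (dart P) (dart∈ P) (trans (cong (side C) (dart-src P)) x∈X)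
        where
        emerald-in : ∀ c → c ∈ T → side C (src c) ≡ side C r → side C (inj₂ (emerald c)) ≡ side C r
        -- The only edge of `T` leaving `X` has its emerald end in `X`, so no edge of `T` leads from
        -- a violet node of `X` to the outside.
        emerald-in (atE e₂ w) c∈ eq = eq
        emerald-in (atV w e₂) c∈ eq = trans
          (sym (constant C (atV w e₂) c∈ (λ ()) (λ { refl → separates C (sym eq) }))) eq
      D₀ : Cut T′ (atE e₁ v₂)
      D₀ = proj₂ tree′ (atE e₁ v₂) (φ-∈ e₁ v₁ P∈)
      go : Dec (side D₀ (inj₂ e₁) ≡ side D₀ r) → Child x
      go (no e₁-sep) = record
        { up = P ; down = atE e₁ v₂ ; down∈ = φ-∈ e₁ v₁ P∈ ; D = D₀ ; sep = e₁-sep ; down-in = e₁∈X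
        ; up∈ = P∈ ; emeralds = refl ; violets = refl }
      -- Here the violet end is the one separated from `r`, and `closed` is what keeps it in `X`.
      go (yes e₁~r) = record
        { up = P ; down = atV v₂ e₁ ; down∈ = φ-∈ e₁ v₁ P∈ ; D = cut-flip D₀
        ; sep = λ eq → separates D₀ (trans e₁~r (sym eq)) ; down-in = closed v₂ e₁ e₁∈X (φ-∈ e₁ v₁ P∈)
        ; up∈ = P∈ ; emeralds = refl ; violets = refl }

    child-injective : ∀ {x y} (p : Child x) (q : Child y) → src (down p) ≡ src (down q) → x ≡ y
    child-injective p q eq = parent-injective tree (up p) (up q) same-violet same-emerald
      where
      same-down : down p ≡ down q
      same-down = separator-unique tree′ r (down p) (down q) (down∈ p) (down∈ q) eq (D p) (D q) (sep p) (sep q)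
      same-emerald : emerald (dart (up p)) ≡ emerald (dart (up q))
      same-emerald = trans (sym (emeralds p)) (trans (cong emerald same-down) (emeralds q))
      φ-cancel : ∀ {e₁ e₂ v₁ v₂} h₁ h₂ → e₁ ≡ e₂ → φ e₁ v₁ h₁ ≡ φ e₂ v₂ h₂ → v₁ ≡ v₂
      φ-cancel h₁ h₂ refl = φ-injective _ _ _ h₁ h₂
      same-violet : violet (dart (up p)) ≡ violet (dart (up q))
      same-violet = φ-cancel (up∈ p) (up∈ q) same-emerald
        (trans (sym (violets p)) (trans (cong violet same-down) (violets q)))

    -- The identity outside `X` extends the injection to all nodes, so pigeonhole applies to the
    -- whole node set.
    image : ∀ x → Dec (side C x ≡ side C r) → Node H
    image x (yes x∈X) = src (down (child x x∈X))
    image x (no _)    = x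

    image-injective : ∀ x y dx dy → image x dx ≡ image y dy → x ≡ y
    image-injective x y (yes p) (yes q) eq = child-injective (child x p) (child y q) eq
    image-injective x y (no _)  (no _)  eq = eq
    image-injective x y (yes p) (no ¬q) eq = contradiction (trans (cong (side C) (sym eq)) (down-in (child x p))) ¬q
    image-injective x y (no ¬p) (yes q) eq = contradiction (trans (cong (side C) eq) (down-in (child y q))) ¬p

    image-avoids : ∀ x dx → image x dx ≢ r
    image-avoids x (yes p) eq = sep (child x p) (cong (side (D (child x p))) eq)
    image-avoids x (no ¬p) eq = ¬p (cong (side C) eq)

    γ : Node H → Node H
    γ x = image x (side C x Bool.≟ side C r)

    γ-injective : ∀ x y → γ x ≡ γ y → x ≡ y
    γ-injective x y = image-injective x y (side C x Bool.≟ side C r) (side C y Bool.≟ side C r)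

    γ-avoids : ∀ x → γ x ≢ r
    γ-avoids x = image-avoids x (side C x Bool.≟ side C r)

  -- Uniqueness: the first disagreement

  -- At a violet node, `T′` would have rejected the edge earlier, at its emerald end, while the
  -- tours still agreed. At an emerald node `cut-count` applies with the cut of `ve`.
  no-divergence : ∀ {T T′} → _⊆_ {H} T′ (inc H) → IsTree {H} T → IsTree {H} T′ → CutsAtEmerald T → CutsAtEmerald T′ →
    (∀ e → degE H T e ≤ degE H T′ e) →
    ∀ t → (∀ k → k < t → has T (τ T k) ≡ has T′ (τ T k)) → (∀ k → k ≤ t → τ T′ k ≡ τ T k) →
    ∀ d → τ T t ≡ d → d ∈ T → d ∉ T′ → ⊥
  no-divergence {T} {T′} T′⊆ tree tree′ J J′ deg≤ t agree same-tour (atV v e) at-t d∈ d∉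
    with J′ v e (subst (_∈ inc H) at-t (tour-inc T t)) d∉
  ... | i , j , i<j , at-i , at-j , fresh with ≤-<-connex t i
  ...   | inj₁ t≤i = fresh-distinct fresh (≤-<-trans t≤i i<j) ≤-refl (trans (same-tour t ≤-refl) (trans at-t (sym at-j)))
  ...   | inj₂ i<t = true≢false (trans (sym d∈) (trans
    (subst (λ c → has T c ≡ has T′ c) (trans (sym (same-tour i (<⇒≤ i<t))) at-i) (agree i i<t)) d∉))
  no-divergence {T} {T′} T′⊆ tree tree′ J J′ deg≤ t agree same-tour (atE e v) at-t d∈ d∉ =
    cut-count tree tree′ deg≤ e v d∈ C closed
    where
    C : Cut T (atE e v)
    C = proj₂ tree (atE e v) d∈
    closed : ∀ v₁ e₁ → side C (inj₂ e₁) ≡ side C (inj₂ e) → T′ v₁ e₁ ≡ true → side C (inj₁ v₁) ≡ side C (inj₂ e)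
    closed v₁ e₁ e₁∈X ∈T′ = decidable-stable (side C (inj₁ v₁) Bool.≟ side C (inj₂ e)) λ v₁∉X → leaves v₁∉X (T v₁ e₁) refl
      where
      leaves : side C (inj₁ v₁) ≢ side C (inj₂ e) → ∀ b → T v₁ e₁ ≡ b → ⊥
      leaves v₁∉X true  ∈T with crossing C (atE e₁ v₁) ∈T (λ eq → v₁∉X (trans (sym eq) e₁∈X))
      ... | inj₁ refl = true≢false (trans (sym ∈T′) d∉)
      leaves v₁∉X false ∉T with J v₁ e₁ (T′⊆ (atE e₁ v₁) ∈T′) ∉T
      ... | i , j , i<j , at-i , at-j , fresh with <-cmp i t
      ...   | tri< i<t _ _ = true≢false (trans (sym ∈T′) (trans
        (sym (subst (λ c → has T c ≡ has T′ c) at-i (agree i i<t))) ∉T))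
      ...   | tri≈ _ refl _ = ∉⇒≢ {R = T} d∈ ∉T (trans (sym at-t) at-i)
      -- Going on to `v₁`, the tour of `T` would have to leave `X` through `ve` again, although it
      -- did so at time `t`.
      ...   | tri> _ _ t<i with tour-crosses C i j (<⇒≤ i<j)
                (trans (cong (side C ∘ src) at-i) e₁∈X)
                (trans (cong (side C ∘ src) at-j) (≢⇒both≡ v₁∉X (separates C ∘ sym)))
      ...     | c , i≤c , c<j , at-c =
        fresh-distinct fresh (<-≤-trans t<i i≤c) (<⇒≤ c<j) (trans at-t (sym at-c))

  jaeger-unique : ∀ {T T′} → _⊆_ {H} T (inc H) → _⊆_ {H} T′ (inc H) → IsTree {H} T → IsTree {H} T′ →
    CutsAtEmerald T → CutsAtEmerald T′ → (∀ e → degE H T e ≡ degE H T′ e) →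
    ∀ v e → T v e ≡ false → T′ v e ≡ true → ⊥
  -- `J` supplies a time at which the tour of `T` is at the disputed edge, so a first difference
  -- exists.
  jaeger-unique {T} {T′} T⊆ T′⊆ tree tree′ J J′ deg v e ∉T ∈T′ with J v e (T′⊆ (atE e v) ∈T′) ∉T
  ... | i , _ , _ , at-i , _
    with first-difference T T′ i
           (λ eq → true≢false (trans (sym ∈T′) (trans (sym (subst (λ c → has T c ≡ has T′ c) at-i eq)) ∉T)))
  ...   | t , _ , diff , agree , same-tour = split (has T (τ T t)) (has T′ (τ T t)) refl refl
    where
    split : ∀ b b′ → has T (τ T t) ≡ b → has T′ (τ T t) ≡ b′ → ⊥
    split true true p q = diff (trans p (sym q))
    split false false p q = diff (trans p (sym q))
    split true false p q =
      no-divergence T′⊆ tree tree′ J J′ (≤-reflexive ∘ deg) t agree same-tour (τ T t) refl p q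
    split false true p q =
      no-divergence T⊆ tree′ tree J′ J (≤-reflexive ∘ sym ∘ deg) t
        (λ k k<t → subst (λ c → has T′ c ≡ has T c) (sym (same-tour k (<⇒≤ k<t))) (sym (agree k k<t)))
        (λ k k≤t → sym (same-tour k k≤t)) (τ T t) (same-tour t ≤-refl) q p

-- From degrees to hypertrees

another-node : ∀ {H} (d : St H) (e : Fin (n H)) → Σ (Node H) λ x → x ≢ inj₂ e
another-node (atV v _) e = inj₁ v , λ ()
another-node (atE _ v) e = inj₁ v , λ ()

-- The truncated subtraction in `fE` would hide degree 0. Connectivity excludes it, since the base
-- state supplies a node other than `e`.
degE>0 : ∀ {H T} → ConnectedSub H T → St H → ∀ e → 0 < degE H T e
degE>0 {H} {T} conn d e with another-node d e
... | x , x≢e = first-edge (conn (inj₂ e) x) x≢e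
  where
  first-edge : ∀ {x} → Star (Adj H T) (inj₂ e) x → x ≢ inj₂ e → 0 < degE H T e
  first-edge ε x≢e = contradiction refl x≢e
  first-edge (_◅_ {j = inj₁ v} a _) _ = countTrue>0 (λ w → T w e) v a

theorem6p15 : (H : Hypergraph) → Connected H → (ρ : Ribbon H) →
    (s₀ : St H) → ValidSt H s₀ →
    (f : Fin (n H) → ℕ) → Hypertree H f →
    Σ (Fin (m H) → Fin (n H) → Bool) (λ T →
    (ECutJaeger H ρ s₀ T × (∀ e → fE H T e ≡ f e)) ×
    (∀ T′ → ECutJaeger H ρ s₀ T′ → (∀ e → fE H T′ e ≡ f e) →
    ∀ v e → T′ v e ≡ T v e))
theorem6p15 H _ ρ s₀ valid f (T₀ , span₀@(T₀⊆ , _) , deg₀)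
  -- This fuel suffices whatever the value of `T₀` is.
  with jaeger-exists ρ s₀ (valid⇒∈ s₀ valid) f (2 ^ dart-bound H) T₀
         (⊆-intro T₀⊆ , spanning⇒tree span₀ , deg₀) (m≤n+m _ _)
... | T , (T⊆ , tree , deg) , J =
  T , ((((λ v e → T⊆ (atV v e)) , proj₁ tree , tree⇒acyclic tree) , J) , fE≡f) , unique
  where
  s₀∈ = valid⇒∈ s₀ valid
  fE≡f : ∀ e → fE H T e ≡ f e
  fE≡f e = trans (cong (_∸ 1) (deg e)) (m+n∸n≡m (f e) 1)
  unique : ∀ T′ → ECutJaeger H ρ s₀ T′ → (∀ e → fE H T′ e ≡ f e) → ∀ v e → T′ v e ≡ T v e
  unique T′ (span′@(T′⊆ , _) , J′) f′ v e = agree (T v e) (T′ v e) refl refl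
    where
    tree′ : IsTree T′
    tree′ = spanning⇒tree span′
    same-deg : ∀ e → degE H T e ≡ degE H T′ e
    same-deg e = trans (deg e) (trans (cong (_+ 1) (sym (f′ e))) (m∸n+n≡m (degE>0 (proj₁ tree′) s₀ e)))
    agree : ∀ b b′ → T v e ≡ b → T′ v e ≡ b′ → T′ v e ≡ T v e
    agree true  true  p q = trans q (sym p)
    agree false false p q = trans q (sym p)
    agree false true  p q = ⊥-elim
      (jaeger-unique ρ s₀ s₀∈ T⊆ (⊆-intro T′⊆) tree tree′ J J′ same-deg v e p q)
    agree true  false p q = ⊥-elim
      (jaeger-unique ρ s₀ s₀∈ (⊆-intro T′⊆) T⊆ tree′ tree J′ J (sym ∘ same-deg) v e q p)
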